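{- (1) $\mathrm{A}_\ell\text{ -NP-sel}\subsetneq(\mathrm{NP}\cap\mathrm{coNP})/n+1$. (2) $\mathrm{A}_\ell\text{ -NPMV-sel}\subsetneq \mathrm{NP}/n+1\,\cap\,\mathrm{coNP}/n+1$.
   Context: $\Sigma=\{0,1\}$. A 2-ary, possibly partial, possibly multivalued function $f$ assigns to each $(x,y)\in\Sigma^*\times\Sigma^*$ a set of values $\text{set- }f(x,y)\subseteq\Sigma^*$; $f(x,y)$ is undefined iff this set is empty; $f$ is total if it is never empty and single-valued if it always has at most one element. For sets $A$, $\text{set- }f(A,y)=\bigcup_{a\in A}\text{set- }f(a,y)$ and $\text{set- }f(y,A)=\bigcup_{a\in A}\text{set- }f(y,a)$. NPMV is the class of such functions $f$ for which there is a nondeterministic polynomial-time Turing machine $M$ such that for all $x,y$ the set of strings output on accepting paths of $M(x,y)$ equals $\text{set- }f(x,y)$; $\mathrm{NPSV}_t$ is the class of total, single-valued functions in NPMV. For a function class $\mathcal F$, an $\mathcal F$-selector function for $B\subseteq\Sigma^*$ is an $f\in\mathcal F$ such that for all $x,y$: $\text{set- }f(x,y)\subseteq\{x,y\}$, and if $\{x,y\}\cap B\neq\emptyset$ then $\text{set- }f(x,y)\neq\emptyset$ and $\text{set- }f(x,y)\subseteq B$. $f$ is associative at each length if for every $n$ and all $a,b,c\in\Sigma^n$, $\text{set- }f(a,\text{set- }f(b,c))=\text{set- }f(\text{set- }f(a,b),c)$. $\mathrm{A}_\ell$-NP-sel (respectively $\mathrm{A}_\ell$-NPMV-sel) is the class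 of sets having an $\mathrm{NPSV}_t$-selector (respectively NPMV-selector) function that is associative at each length. For a complexity class $\mathcal C$, a set $B$ is in $\mathcal C/n+1$ if there are $C\in\mathcal C$ and a function $h:1^*\to\Sigma^*$ (not necessarily computable) such that for all $x\in\Sigma^*$: $|h(1^{|x|})|=|x|+1$ and $x\in B\iff\langle x,h(1^{|x|})\rangle\in C$, where $\langle\cdot,\cdot\rangle$ is a standard polynomial-time computable and invertible pairing function. -}

module Defs where

open import Level using (Level; 0ℓ; _⊔_) renaming (suc to lsuc)
open import Data.Bool.Base using (Bool; true; false)
open import Data.Fin.Base using (Fin; zero; suc)
open import Data.List.Base using (List; []; _∷_; _++_; length; map; fromMaybe)
open import Data.List.Membership.Propositional using () renaming (_∈_ to _∈ˡ_)
open import Data.Maybe.Base using (Maybe)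
open import Data.Nat.Base using (ℕ; zero; suc; _+_; _*_; _≤_)
open import Data.Product.Base using (∃; ∃-syntax; _×_)
open import Data.Vec.Base using (Vec; _∷_; replicate) renaming (map to mapᵛ; zipWith to zipWithᵛ)
open import Function.Bundles using (_⇔_)
open import Relation.Binary.PropositionalEquality using (_≡_; _≢_)
open import Relation.Unary using (Pred; _∈_; _⊆_; _≐_; _≬_; _∩_; _∪_; ∁; ｛_｝; Satisfiable)

Str : Set
Str = List Bool

Language : Set₁
Language = Pred Str 0ℓ

Class : (ℓ : Level) → Set (lsuc 0ℓ ⊔ lsuc ℓ)
Class ℓ = Pred Language ℓ

-- Bits of x doubled, then the delimiter 01, then y verbatim.
⟨_,_⟩ : Str → Str → Str
⟨ []    , y ⟩ = false ∷ true ∷ y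
⟨ b ∷ x , y ⟩ = b ∷ b ∷ ⟨ x , y ⟩

-- Coefficients of a polynomial over ℕ, constant term first.
Polynomial : Set
Polynomial = List ℕ

eval : Polynomial → ℕ → ℕ
eval []      n = 0
eval (a ∷ p) n = a + n * eval p n

-- A tape infinite in both directions; each list holds the cells on one side of
-- the head, nearest cell first, and all cells beyond its end are blank.
record Tape (Γ : Set) : Set where
  constructor tape
  field
    left  : List Γ
    head  : Γ
    right : List Γ

data Move : Set where
  ◂ stay ▸ : Move

write : ∀ {Γ} → Γ → Tape Γ → Tape Γ
write s (tape l _ r) = tape l s r

move : ∀ {Γ} → (blank : Γ) → Move → Tape Γ → Tape Γ
move _     stay t                  = t
move blank ◂    (tape []      s r) = tape [] blank (s ∷ r)
move _     ◂    (tape (a ∷ l) s r) = tape l a (s ∷ r)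
move blank ▸    (tape l s [])      = tape (s ∷ l) blank []
move _     ▸    (tape l s (a ∷ r)) = tape (s ∷ l) a r

record Action (Q Γ : Set) (k : ℕ) : Set where
  constructor action
  field
    next    : Q
    symbols : Vec Γ k
    moves   : Vec Move k
    emit    : Maybe Bool   -- bit appended to the write-only output tape, if any

-- A nondeterministic multitape Turing machine with a one-way, write-only output
-- tape.  The symbols 0, 1, 2 of the tape alphabet are the blank and the bits 0, 1.
record NTM : Set where
  field
    #states #extraTapes #extraSymbols : ℕ

  State : Set
  State = Fin #states

  Symbol : Set
  Symbol = Fin (3 + #extraSymbols)

  #tapes : ℕ
  #tapes = suc #extraTapes

  field
    start accept : State
    δ : State → Vec Symbol #tapes → List (Action State Symbol #tapes)

module Computation (M : NTM) where
  open NTM M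

  blank : Symbol
  blank = zero

  bit : Bool → Symbol
  bit false = suc zero
  bit true  = suc (suc zero)

  record Config : Set where
    constructor config
    field
      state  : State
      tapes  : Vec (Tape Symbol) #tapes
      output : Str

  inputTape : Str → Tape Symbol
  inputTape []      = tape [] blank []
  inputTape (b ∷ w) = tape [] (bit b) (map bit w)

  initial : Str → Config
  initial w = config start (inputTape w ∷ replicate #extraTapes (tape [] blank [])) []

  scanned : Config → Vec Symbol #tapes
  scanned c = mapᵛ Tape.head (Config.tapes c)

  apply : Action State Symbol #tapes → Config → Config
  apply (action q ss ms e) (config _ ts o) =
    config q (zipWithᵛ (move blank) ms (zipWithᵛ write ss ts)) (o ++ fromMaybe e)

  -- A path halts on entering the accepting state, or (rejecting) when no action
  -- is available.
  data Path : Config → ℕ → Config → Set where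
    done : ∀ {c} → Path c 0 c
    step : ∀ {c d t} (a : Action State Symbol #tapes) →
           Config.state c ≢ accept → a ∈ˡ δ (Config.state c) (scanned c) →
           Path (apply a c) t d → Path c (suc t) d

  PolynomialTime : Set
  PolynomialTime =
    ∃[ p ] ∀ w {t c} → Path (initial w) t c → t ≤ eval p (length w)

  Accepts : Str → Set
  Accepts w = ∃[ t ] ∃[ c ] Path (initial w) t c × Config.state c ≡ accept

  Outputs : Str → Str → Set
  Outputs w z =
    ∃[ t ] ∃[ c ] Path (initial w) t c × Config.state c ≡ accept × Config.output c ≡ z

NP : Class 0ℓ
NP A = ∃[ M ] Computation.PolynomialTime M × (∀ x → x ∈ A ⇔ Computation.Accepts M x)

coNP : Class 0ℓ
coNP A = ∁ A ∈ NP

-- The advice function takes n in place of 1ⁿ.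
infix 8 _/n+1
_/n+1 : ∀ {ℓ} → Class ℓ → Class (lsuc 0ℓ ⊔ ℓ)
(𝒞 /n+1) B =
  ∃ λ (C : Language) → ∃ λ (h : ℕ → Str) → C ∈ 𝒞 ×
    (∀ x → length (h (length x)) ≡ length x + 1 × (x ∈ B ⇔ ⟨ x , h (length x) ⟩ ∈ C))

-- f x y is set-f(x,y); f is undefined at (x , y) when this set is empty.
MVFun : Set₁
MVFun = Str → Str → Pred Str 0ℓ

-- set-f(A,y) and set-f(y,A).
imageˡ : MVFun → Pred Str 0ℓ → Str → Pred Str 0ℓ
imageˡ f A y z = ∃[ a ] a ∈ A × z ∈ f a y

imageʳ : MVFun → Str → Pred Str 0ℓ → Pred Str 0ℓ
imageʳ f y A z = ∃[ a ] a ∈ A × z ∈ f y a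

Total : MVFun → Set
Total f = ∀ x y → Satisfiable (f x y)

SingleValued : MVFun → Set
SingleValued f = ∀ x y {z z′} → z ∈ f x y → z′ ∈ f x y → z ≡ z′

NPMV : Pred MVFun 0ℓ
NPMV f = ∃[ M ] Computation.PolynomialTime M ×
  (∀ x y z → z ∈ f x y ⇔ Computation.Outputs M ⟨ x , y ⟩ z)

NPSVₜ : Pred MVFun 0ℓ
NPSVₜ f = f ∈ NPMV × Total f × SingleValued f

IsSelector : MVFun → Language → Set
IsSelector f B = ∀ x y →
  f x y ⊆ ｛ x ｝ ∪ ｛ y ｝ ×
  ((｛ x ｝ ∪ ｛ y ｝) ≬ B → Satisfiable (f x y) × f x y ⊆ B)

AssociativeAtEachLength : MVFun → Set
AssociativeAtEachLength f =
  ∀ n a b c → length a ≡ n → length b ≡ n → length c ≡ n →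
  imageʳ f a (f b c) ≐ imageˡ f (f a b) c

-- Sets having an ℱ-selector function that is associative at each length.
Aℓ-selective : Pred MVFun 0ℓ → Class (lsuc 0ℓ)
Aℓ-selective ℱ B = ∃[ f ] f ∈ ℱ × IsSelector f B × AssociativeAtEachLength f

Aℓ-NP-sel : Class (lsuc 0ℓ)
Aℓ-NP-sel = Aℓ-selective NPSVₜ

Aℓ-NPMV-sel : Class (lsuc 0ℓ)
Aℓ-NPMV-sel = Aℓ-selective NPMV

{-# OPTIONS --safe #-}
module Submission where

-- Write a ≽ b if a ∈ f(a,b) or a ∈ f(b,a).  On a set of strings of one length on which f is
-- defined, associativity makes ≽ a total preorder.  If w is a lowest member of B at length n,
-- then x ∈ B iff f applied to x and w, in one of the two orders, can output x; and if v is a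
-- highest non-member of B, then x ∉ B iff f applied to x and v can output v.  (As soon as B has
-- a member of length n, associativity forces f to be defined everywhere at this length.)  By
-- transitivity a single order of the arguments works for all x, and the extra bit c of advice
-- names it.  The advice strings 0ⁿ⁺¹ and 1ⁿ⁺¹ are reserved for "reject all" and "accept all";
-- w can always be chosen to avoid them.  One nondeterministic machine, built from a machine for
-- f, decides all these questions: it writes ⟨x,w⟩ or ⟨w,x⟩ on a tape, simulates the given machine
-- and compares its output with x or w bit by bit.
--
-- For strictness, code machines by natural numbers and let membership of a string depend on its
-- length only, the machine with code m being refuted on the lengths 2m and 2m + 1.

open import Defs
open import Level using (0ℓ)
open import Axiom.ExcludedMiddle using (ExcludedMiddle)
open import Data.Bool.Base using (Bool; true; false; _∧_; if_then_else_)
open import Data.Bool.Properties as Bool using ()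
open import Data.Fin.Base using (Fin; zero; suc; toℕ)
open import Data.Fin.Properties as Fin using (toℕ-injective)
open import Data.List.Base
  using (List; []; _∷_; _++_; _ʳ++_; [_]; length; map; lookup; concat; replicate; fromMaybe; allFin;
         cartesianProduct; cartesianProductWith)
open import Data.List.Membership.Propositional using () renaming (_∈_ to _∈ˡ_)
open import Data.List.Membership.Propositional.Properties
  using (∈-map⁺; ∈-map⁻; ∈-++⁺ˡ; ∈-++⁺ʳ; ∈-concat⁺; ∈-cartesianProduct⁺; ∈-cartesianProductWith⁺; ∈-allFin)
open import Data.List.Properties
  using (≡-dec; ++-identityʳ; ++-assoc; ++-cancelˡ; map-ʳ++; length-ʳ++; map-cong; length-replicate)
open import Data.List.Relation.Unary.Any using (Any; here; there; index)
open import Data.List.Relation.Unary.Any.Properties using (lookup-index)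
open import Data.Maybe.Base as Maybe using (Maybe; just; nothing; maybe′)
open import Data.Nat.Base using (ℕ; zero; suc; _+_; _*_; _≤_; z≤n; s≤s)
open import Data.Nat.Properties
  using (≤-trans; ≤-reflexive; +-mono-≤; +-monoʳ-≤; *-mono-≤; *-monoʳ-≤; m≤m+n; n≤1+n;
         +-suc; +-comm; +-identityʳ; *-zeroʳ; *-cancelˡ-≡; suc-injective; even≢odd)
open import Data.Nat.Tactic.RingSolver using (solve-∀)
open import Data.Product.Base using (∃; ∃₂; ∃-syntax; _×_; _,_; proj₁; proj₂)
open import Data.Sum.Base using (_⊎_; inj₁; inj₂; [_,_]′; swap)
open import Data.Vec.Base as Vec using (Vec; []; _∷_; tabulate) renaming (map to mapᵛ; zipWith to zipWithᵛ)
open import Data.Vec.Properties using (lookup∘tabulate)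
open import Function.Base using (_∘_; id)
open import Function.Bundles using (_⇔_; mk⇔; Equivalence; _↣_; mk↣; Injection)
open import Relation.Binary.PropositionalEquality
  using (_≡_; _≢_; refl; sym; trans; cong; cong₂; subst; module ≡-Reasoning)
open import Relation.Nullary using (¬_; Dec; yes; no; does; contradiction)
open import Relation.Nullary.Decidable using (dec-true; dec-false; decidable-stable)
open import Relation.Unary
  using (Pred; _∈_; _⊆_; _⊂_; _≐_; _∩_; _∪_; ∁; ｛_｝; Satisfiable)

-- Polynomials

eval-mono : ∀ p {m n} → m ≤ n → eval p m ≤ eval p n
eval-mono []      m≤n = z≤n
eval-mono (a ∷ p) m≤n = +-monoʳ-≤ a (*-mono-≤ m≤n (eval-mono p m≤n))

infixl 6 _⊕_
_⊕_ : Polynomial → Polynomial → Polynomial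
[]      ⊕ q       = q
(a ∷ p) ⊕ []      = a ∷ p
(a ∷ p) ⊕ (b ∷ q) = a + b ∷ p ⊕ q

eval-⊕ : ∀ p q n → eval (p ⊕ q) n ≡ eval p n + eval q n
eval-⊕ []      q       n = refl
eval-⊕ (a ∷ p) []      n = sym (+-identityʳ _)
eval-⊕ (a ∷ p) (b ∷ q) n rewrite eval-⊕ p q n = interchange a b n (eval p n) (eval q n)
  where
  interchange : ∀ a b n x y → a + b + n * (x + y) ≡ a + n * x + (b + n * y)
  interchange = solve-∀

scale : ℕ → Polynomial → Polynomial
scale k = map (k *_)

eval-scale : ∀ k p n → eval (scale k p) n ≡ k * eval p n
eval-scale k []      n = sym (*-zeroʳ k)
eval-scale k (a ∷ p) n rewrite eval-scale k p n = distribute k a n (eval p n)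
  where
  distribute : ∀ k a n x → k * a + n * (k * x) ≡ k * (a + n * x)
  distribute = solve-∀

dilate : Polynomial → Polynomial
dilate []      = []
dilate (a ∷ p) = a ∷ scale 2 (dilate p)

eval-dilate : ∀ p n → eval (dilate p) n ≡ eval p (2 * n)
eval-dilate []      n = refl
eval-dilate (a ∷ p) n rewrite eval-scale 2 (dilate p) n | eval-dilate p n =
  reassociate a n (eval p (2 * n))
  where
  reassociate : ∀ a n x → a + n * (2 * x) ≡ a + 2 * n * x
  reassociate = solve-∀

-- The machine comparing the output of a given machine with a reference string

sameBit : Bool → Bool → Bool
sameBit b b′ = does (b Bool.≟ b′)

constant : Bool → Str → Bool
constant c []      = true
constant c (b ∷ w) = sameBit b c ∧ constant c w

infix 4 _≟ˢ_
_≟ˢ_ : (x y : Str) → Dec (x ≡ y)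
_≟ˢ_ = ≡-dec Bool._≟_

query : Bool → Str → Str → Str
query false x w = ⟨ x , w ⟩
query true  x w = ⟨ w , x ⟩

module Verdict (M : NTM) (advised : Bool) where

  open Computation M using (Outputs)

  reference : Str → Str → Str
  reference x w = if advised then w else x

  -- The fourth argument says whether `w` is one of the reserved strings, in which case the flag is
  -- the verdict. Otherwise a verdict `v` is witnessed by one output, so for a multivalued machine
  -- both verdicts may hold.
  Judged : Str → Bool → Str → Bool → Bool → Set
  Judged x c w true  v = c ≡ v
  Judged x c w false v = ∃[ o ] Outputs (query c x w) o × does (o ≟ˢ reference x w) ≡ v

  -- acc is the part of the first component read so far, reversed.
  VerdictFrom : Str → Str → Bool → Set
  VerdictFrom acc (false ∷ false ∷ s)    v = VerdictFrom (false ∷ acc) s v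
  VerdictFrom acc (true ∷ true ∷ s)      v = VerdictFrom (true ∷ acc) s v
  VerdictFrom acc (false ∷ true ∷ c ∷ w) v = Judged (acc ʳ++ []) c w (constant c w) v
  -- Inputs without a flag get the verdict `false`, so that every string, well formed or not, has a
  -- verdict and complements can be taken on all strings.
  VerdictFrom acc (false ∷ true ∷ [])    v = false ≡ v
  VerdictFrom acc (true ∷ false ∷ s)     v = false ≡ v
  VerdictFrom acc (_ ∷ [])               v = false ≡ v
  VerdictFrom acc []                     v = false ≡ v

  Verdict : Str → Bool → Set
  Verdict = VerdictFrom []

  verdictFrom-pair : ∀ acc x c w v →
    VerdictFrom acc ⟨ x , c ∷ w ⟩ v ≡ Judged (acc ʳ++ x) c w (constant c w) v
  verdictFrom-pair acc []          c w v = refl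
  verdictFrom-pair acc (false ∷ x) c w v = verdictFrom-pair (false ∷ acc) x c w v
  verdictFrom-pair acc (true ∷ x)  c w v = verdictFrom-pair (true ∷ acc) x c w v

  verdict-pair : ∀ x c w v → Verdict ⟨ x , c ∷ w ⟩ v ≡ Judged x c w (constant c w) v
  verdict-pair = verdictFrom-pair []

-- `parse₂ b` remembers the first bit of a doubled pair, the last argument of `advice` whether the
-- advice read so far repeats the flag, and `first₁`, `first₂` the bit to be written twice.
data Phase : Set where
  parse₁ flag accepting : Phase
  parse₂                : Bool → Phase
  advice                : (c constant : Bool) → Phase
  second delim first    : (c : Bool) → Phase
  first₁ first₂         : (c read : Bool) → Phase

-- Finite coding of the control states

bools : List Bool
bools = false ∷ true ∷ []

∈-bools : ∀ b → b ∈ˡ bools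
∈-bools false = here refl
∈-bools true  = there (here refl)

phaseBlocks : List (List Phase)
phaseBlocks =
  ( (parse₁ ∷ flag ∷ accepting ∷ []) ∷ map parse₂ bools ∷ cartesianProductWith advice bools bools
  ∷ map second bools ∷ map delim bools ∷ map first bools
  ∷ cartesianProductWith first₁ bools bools ∷ cartesianProductWith first₂ bools bools ∷ [])

∈-phases : ∀ p → p ∈ˡ concat phaseBlocks
∈-phases p = ∈-concat⁺ (block p)
  where
  block : ∀ p → Any (p ∈ˡ_) phaseBlocks
  block parse₁       = here (here refl)
  block flag         = here (there (here refl))
  block accepting    = here (there (there (here refl)))
  block (parse₂ b)   = there (here (∈-map⁺ parse₂ (∈-bools b)))
  block (advice c u) = there (there (here (∈-cartesianProductWith⁺ advice (∈-bools c) (∈-bools u))))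
  block (second c)   = there (there (there (here (∈-map⁺ second (∈-bools c)))))
  block (delim c)    = there (there (there (there (here (∈-map⁺ delim (∈-bools c))))))
  block (first c)    = there (there (there (there (there (here (∈-map⁺ first (∈-bools c)))))))
  block (first₁ c b) = there (there (there (there (there (there (here
                         (∈-cartesianProductWith⁺ first₁ (∈-bools c) (∈-bools b))))))))
  block (first₂ c b) = there (there (there (there (there (there (there (here
                         (∈-cartesianProductWith⁺ first₂ (∈-bools c) (∈-bools b)))))))))

-- A simulation state pairs a state of the simulated machine with the record of whether
-- its output so far is a prefix of the reference string.
Control : ℕ → Set
Control n = Phase ⊎ (Fin n × Bool)

abstract

  -- The enumeration turns structured states into the `Fin` that `NTM` asks for. It is abstract
  -- because only `decode-encode` matters later.
  controls : ∀ n → List (Control n)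
  controls n = map inj₁ (concat phaseBlocks) ++ map inj₂ (cartesianProduct (allFin n) bools)

  ∈-controls : ∀ {n} (p : Control n) → p ∈ˡ controls n
  ∈-controls (inj₁ p)       = ∈-++⁺ˡ (∈-map⁺ inj₁ (∈-phases p))
  ∈-controls (inj₂ (q , g)) =
    ∈-++⁺ʳ (map inj₁ (concat phaseBlocks))
      (∈-map⁺ inj₂ (∈-cartesianProduct⁺ (∈-allFin q) (∈-bools g)))

  #controls : ℕ → ℕ
  #controls n = length (controls n)

  encode : ∀ {n} → Control n → Fin (#controls n)
  encode p = index (∈-controls p)

  decode : ∀ {n} → Fin (#controls n) → Control n
  decode = lookup (controls _)

  decode-encode : ∀ {n} (p : Control n) → decode (encode p) ≡ p
  decode-encode p = sym (lookup-index (∈-controls p))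

-- Transition function of the machine

module Judge (M : NTM) (advised target : Bool) where

  open NTM M
  open Verdict M advised
  private module M = Computation M
  open M using (blank; bit; inputTape)

  bit? : Symbol → Maybe Bool
  bit? (suc zero)       = just false
  bit? (suc (suc zero)) = just true
  bit? _                = nothing

  record Instruction : Set where
    constructor instruction
    field
      goto        : Control #states
      onA onX onI : Symbol × Move

  -- A path rejects by having no action, so a verdict other than `target` is `nothing`.
  conclude : Bool → Symbol → Symbol → Symbol → Maybe Instruction
  conclude v a x i =
    if sameBit v target
    then just (instruction (inj₁ accepting) (a , stay) (x , stay) (i , stay))
    else nothing

  -- The input tape A, the tape X receiving x, and the input tape I of the simulated machine.
  -- The query is written on I from right to left, so that I ends up as an initial tape exactly.
  -- The flag c on A is overwritten by a blank, which delimits w when it is read backwards.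
  control : Phase → Symbol → Symbol → Symbol → Maybe Instruction
  control accepting a x i = nothing
  control parse₁ a x i = maybe′
    (λ b → just (instruction (inj₁ (parse₂ b)) (a , ▸) (x , stay) (i , stay)))
    (conclude false a x i) (bit? a)
  control (parse₂ b) a x i = maybe′ (bits b) (conclude false a x i) (bit? a)
    where
    bits : Bool → Bool → Maybe Instruction
    bits false true = just (instruction (inj₁ flag) (a , ▸) (x , stay) (i , stay))
    bits true false = conclude false a x i
    bits _     b    = just (instruction (inj₁ parse₁) (a , ▸) (bit b , ▸) (i , stay))
  control flag a x i = maybe′
    (λ c → just (instruction (inj₁ (advice c true)) (blank , ▸) (x , stay) (i , stay)))
    (conclude false a x i) (bit? a)
  control (advice c u) a x i = maybe′
    (λ b → just (instruction (inj₁ (advice c (u ∧ sameBit b c))) (a , ▸) (x , stay) (i , stay)))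
    (if u then conclude c a x i
     else just (instruction (inj₁ (second c)) (a , ◂) (x , ◂) (i , stay)))
    (bit? a)
  control (second false) a x i = maybe′
    (λ b → just (instruction (inj₁ (second false)) (a , ◂) (x , stay) (bit b , ◂)))
    (just (instruction (inj₁ (delim false)) (a , stay) (x , stay) (bit true , ◂)))
    (bit? a)
  control (second true) a x i = maybe′
    (λ b → just (instruction (inj₁ (second true)) (a , stay) (x , ◂) (bit b , ◂)))
    (just (instruction (inj₁ (delim true)) (a , stay) (x , stay) (bit true , ◂)))
    (bit? x)
  -- The head stays on this cell, and each later cell is written after a move to the left, so no
  -- blank is left on I in front of the query.
  control (delim c) a x i =
    just (instruction (inj₁ (first c)) (a , stay) (x , stay) (bit false , stay))
  control (first false) a x i = maybe′
    (λ b → just (instruction (inj₁ (first₁ false b)) (a , stay) (x , ◂) (i , ◂)))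
    -- Both heads are on the blanks just before `w` and `x`; one move puts them on the first bits,
    -- where the comparison starts.
    (just (instruction (inj₂ (start , true)) (a , ▸) (x , ▸) (i , stay)))
    (bit? x)
  control (first true) a x i = maybe′
    (λ b → just (instruction (inj₁ (first₁ true b)) (a , ◂) (x , stay) (i , ◂)))
    (just (instruction (inj₂ (start , true)) (a , ▸) (x , ▸) (i , stay)))
    (bit? a)
  control (first₁ c b) a x i =
    just (instruction (inj₁ (first₂ c b)) (a , stay) (x , stay) (bit b , ◂))
  control (first₂ c b) a x i =
    just (instruction (inj₁ (first c)) (a , stay) (x , stay) (bit b , stay))

  #heads : ℕ
  #heads = 2 + #tapes

  toAction : Vec Symbol #extraTapes → Instruction → Action (Control #states) Symbol #heads
  toAction ss (instruction q (a , m) (x , m′) (i , m″)) =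
    action q (a ∷ x ∷ i ∷ ss) (m ∷ m′ ∷ m″ ∷ Vec.replicate _ stay) nothing

  -- Emitted bits are checked at once against the reference string and never stored. A mismatch, or
  -- a bit beyond the end of the reference, sets the record to `false` for good.
  compare : Bool → Symbol → Maybe Bool → Bool × Move
  compare true  r (just b) = maybe′ (λ b′ → if sameBit b′ b then true , ▸ else false , stay)
                                    (false , stay) (bit? r)
  compare g     r _        = g , stay

  read : Symbol → Symbol → Symbol
  read a x = if advised then a else x

  lift : Bool → Symbol → Symbol → Action State Symbol #tapes → Action (Control #states) Symbol #heads
  lift g a x (action q ss ms e) =
    action (inj₂ (q , proj₁ next)) (a ∷ x ∷ ss)
      ((if advised then proj₂ next else stay) ∷ (if advised then stay else proj₂ next) ∷ ms) nothing
    where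
    next : Bool × Move
    next = compare g (read a x) e

  -- A prefix of the reference is all of it exactly when the head has reached the blank behind it.
  agrees : Bool → Symbol → Bool
  agrees g r = g ∧ maybe′ (λ _ → false) true (bit? r)

  finished : Symbol → Symbol → Vec Symbol #tapes → Action (Control #states) Symbol #heads
  finished a x ss = action (inj₁ accepting) (a ∷ x ∷ ss) (stay ∷ stay ∷ Vec.replicate _ stay) nothing

  δ′ : Control #states → Vec Symbol #heads → List (Action (Control #states) Symbol #heads)
  δ′ (inj₁ p)       (a ∷ x ∷ i ∷ ss) = fromMaybe (Maybe.map (toAction ss) (control p a x i))
  δ′ (inj₂ (q , g)) (a ∷ x ∷ ss)     with q Fin.≟ accept
  -- `M` halts on entering `accept`, so only the final comparison remains.
  ... | yes _ = if sameBit (agrees g (read a x)) target then finished a x ss ∷ [] else []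
  ... | no  _ = map (lift g a x) (δ q ss)

  relabel : Action (Control #states) Symbol #heads →
            Action (Fin (#controls #states)) Symbol #heads
  relabel (action q ss ms e) = action (encode q) ss ms e

  judge : NTM
  judge = record
    { #states       = #controls #states
    ; #extraTapes   = 2 + #extraTapes
    ; #extraSymbols = #extraSymbols
    ; start         = encode (inj₁ parse₁)
    ; accept        = encode (inj₁ accepting)
    ; δ             = λ q ss → map relabel (δ′ (decode q) ss)
    }

  -- Time and acceptance along forced steps

  private module J = Computation judge
  open J using (Path; done; step; config; apply)

  Tapes : Set
  Tapes = Vec (Tape Symbol) #tapes

  at : Control #states → Tape Symbol → Tape Symbol → Tapes → J.Config
  at p A X ts = config (encode p) (A ∷ X ∷ ts) []

  heads : ∀ {n} → Vec (Tape Symbol) n → Vec Symbol n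
  heads = mapᵛ Tape.head

  AcceptsFrom : J.Config → Set
  AcceptsFrom c = ∃[ t ] ∃[ d ] Path c t d × J.Config.state d ≡ encode (inj₁ accepting)

  -- Bundling the time bound on all paths with both directions of correctness lets one walk through
  -- the program prove all three.
  record Decides (T : ℕ) (P : Set) (c : J.Config) : Set where
    field
      time     : ∀ {t d} → Path c t d → t ≤ T
      sound    : AcceptsFrom c → P
      complete : P → AcceptsFrom c
  open Decides

  encode-injective : ∀ {p q : Control #states} → encode p ≡ encode q → p ≡ q
  encode-injective {p} {q} eq =
    trans (sym (decode-encode p)) (trans (cong decode eq) (decode-encode q))

  δ-at : ∀ p {ss} → NTM.δ judge (encode p) ss ≡ map relabel (δ′ p ss)
  δ-at p = cong (λ q → map relabel (δ′ q _)) (decode-encode p)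

  weaken : ∀ {T T′ P c} → T ≤ T′ → Decides T P c → Decides T′ P c
  weaken T≤T′ D = record
    { time = λ π → ≤-trans (D .time π) T≤T′ ; sound = D .sound ; complete = D .complete }

  accepting-decides : ∀ {P A X ts} → P → Decides 0 P (at (inj₁ accepting) A X ts)
  accepting-decides p = record
    { time     = λ { done → z≤n ; (step _ ≢accept _ _) → contradiction refl ≢accept }
    ; sound    = λ _ → p
    ; complete = λ _ → 0 , _ , done , refl
    }

  module _ {p : Control #states} {A X : Tape Symbol} {ts : Tapes} (≢accepting : p ≢ inj₁ accepting) where

    private
      actions : List (Action (Control #states) Symbol #heads)
      actions = δ′ p (Tape.head A ∷ Tape.head X ∷ heads ts)

    stuck : ∀ {P} → actions ≡ [] → ¬ P → Decides 0 P (at p A X ts)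
    stuck eq ¬p = record
      { time     = λ { done → z≤n ; (step _ _ a∈ _) → contradiction (none a∈) (λ ()) }
      ; sound    = λ { (_ , _ , done , eq) → contradiction (encode-injective eq) ≢accepting
                     ; (_ , _ , step _ _ a∈ _ , _) → contradiction (none a∈) (λ ()) }
      ; complete = λ p → contradiction p ¬p
      }
      where
      none : ∀ {a} → a ∈ˡ NTM.δ judge (encode p) (Tape.head A ∷ Tape.head X ∷ heads ts) → a ∈ˡ []
      none a∈ rewrite δ-at p {Tape.head A ∷ Tape.head X ∷ heads ts} | eq = a∈

    -- With a single action available, every nonempty path begins with it; the empty path does not
    -- accept because `p` is not `accepting`.
    forced : ∀ {T P a} → actions ≡ a ∷ [] → Decides T P (apply (relabel a) (at p A X ts)) →
             Decides (suc T) P (at p A X ts)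
    forced {a = a} eq D = record
      { time     = λ { done → z≤n ; (step b _ b∈ π) →
                       s≤s (D .time (subst (λ b → Path (apply b (at p A X ts)) _ _) (only b∈) π)) }
      ; sound    = λ { (_ , _ , done , eq) → contradiction (encode-injective eq) ≢accepting
                     ; (_ , _ , step b _ b∈ π , acc) →
                         D .sound (_ , _ , subst (λ b → Path (apply b (at p A X ts)) _ _) (only b∈) π , acc) }
      ; complete = λ p → let t , d , π , acc = D .complete p
                         in suc t , d , step _ (≢accepting ∘ encode-injective) member π , acc
      }
      where
      only : ∀ {b} → b ∈ˡ NTM.δ judge (encode p) (Tape.head A ∷ Tape.head X ∷ heads ts) → b ≡ relabel a
      only b∈ rewrite δ-at p {Tape.head A ∷ Tape.head X ∷ heads ts} | eq with b∈
      ... | here b≡ = b≡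
      member : relabel a ∈ˡ NTM.δ judge (encode p) (Tape.head A ∷ Tape.head X ∷ heads ts)
      member rewrite δ-at p {Tape.head A ∷ Tape.head X ∷ heads ts} | eq = here refl

  keep : ∀ {n} (ts : Vec (Tape Symbol) n) →
    zipWithᵛ (move blank) (Vec.replicate _ stay) (zipWithᵛ write (heads ts) ts) ≡ ts
  keep []       = refl
  keep (t ∷ ts) = cong (t ∷_) (keep ts)

  others : Vec (Tape Symbol) #extraTapes
  others = Vec.replicate _ (tape [] blank [])

  perform : Symbol × Move → Tape Symbol → Tape Symbol
  perform (s , m) t = move blank m (write s t)

  run : ∀ {T P p A X I q α ξ ι} →
    control p (Tape.head A) (Tape.head X) (Tape.head I) ≡ just (instruction q α ξ ι) →
    Decides T P (at q (perform α A) (perform ξ X) (perform ι I ∷ others)) →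
    Decides (suc T) P (at (inj₁ p) A X (I ∷ others))
  run {T} {P} {p} {A} {X} {I} {q} {α} {ξ} {ι} eq D =
    forced {p = inj₁ p} ≢accepting (cong (fromMaybe ∘ Maybe.map (toAction _)) eq)
      (subst (λ ts → Decides T P (at q (perform α A) (perform ξ X) (perform ι I ∷ ts))) (sym (keep others)) D)
    where
    ≢accepting : inj₁ p ≢ inj₁ accepting
    ≢accepting refl = contradiction eq λ ()

  verdict : ∀ {p A X I} v → p ≢ accepting →
    control p (Tape.head A) (Tape.head X) (Tape.head I) ≡ conclude v (Tape.head A) (Tape.head X) (Tape.head I) →
    Decides 1 (v ≡ target) (at (inj₁ p) A X (I ∷ others))
  verdict {p} {A} {X} {I} v ≢accepting eq with v Bool.≟ target
  ... | yes v≡t = run eq (accepting-decides v≡t)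
  ... | no  v≢t = weaken z≤n
    (stuck {p = inj₁ p} (λ { refl → ≢accepting refl }) (cong (fromMaybe ∘ Maybe.map (toAction _)) eq) v≢t)

  onA : ∀ {T P p A A′ X ts} → A ≡ A′ → Decides T P (at p A′ X ts) → Decides T P (at p A X ts)
  onA refl D = D

  onGoal : ∀ {T P P′ c} → P ≡ P′ → Decides T P c → Decides T P′ c
  onGoal refl D = D

  -- Writing the query

  blankTape : Tape Symbol
  blankTape = tape [] blank []

  spell : List Symbol → List Symbol → Tape Symbol
  spell l []      = tape l blank []
  spell l (s ∷ r) = tape l s r

  move-▸ : ∀ l s r → move blank ▸ (tape l s r) ≡ spell (s ∷ l) r
  move-▸ l s []      = refl
  move-▸ l s (_ ∷ r) = refl

  -- The head reads the bits of acc while moving left.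
  behindA : List Symbol → Str → Symbol → List Symbol → Tape Symbol
  behindA l acc s r = move blank ◂ (tape (map bit acc ++ blank ∷ l) s r)

  behindX : Str → Symbol → List Symbol → Tape Symbol
  behindX acc s r = move blank ◂ (tape (map bit acc) s r)

  -- The rest of the run is taken as a continuation. It receives the cells `s′ ∷ r′` through an
  -- equation because a reversed append does not reduce to a cons for unknown `acc`.
  second-A : ∀ {T P l X} acc s r cs →
    (∀ s′ r′ → s′ ∷ r′ ≡ map bit acc ʳ++ s ∷ r →
      Decides T P (at (inj₁ (delim false)) (behindA l [] s′ r′) X
        (tape [] blank (bit true ∷ (map bit acc ʳ++ cs)) ∷ others))) →
    Decides (length acc + suc T) P
      (at (inj₁ (second false)) (behindA l acc s r) X (tape [] blank cs ∷ others))
  second-A []            s r cs D = run refl (D s r refl)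
  second-A (false ∷ acc) s r cs D = run refl (second-A acc _ _ _ D)
  second-A (true ∷ acc)  s r cs D = run refl (second-A acc _ _ _ D)

  second-X : ∀ {T P A} acc s r cs →
    (∀ s′ r′ → s′ ∷ r′ ≡ map bit acc ʳ++ s ∷ r →
      Decides T P (at (inj₁ (delim true)) A (behindX [] s′ r′)
        (tape [] blank (bit true ∷ (map bit acc ʳ++ cs)) ∷ others))) →
    Decides (length acc + suc T) P
      (at (inj₁ (second true)) A (behindX acc s r) (tape [] blank cs ∷ others))
  second-X []            s r cs D = run refl (D s r refl)
  second-X (false ∷ acc) s r cs D = run refl (second-X acc _ _ _ D)
  second-X (true ∷ acc)  s r cs D = run refl (second-X acc _ _ _ D)

  double : Str → List Symbol → List Symbol
  double []        cs = cs
  double (b ∷ acc) cs = double acc (bit b ∷ bit b ∷ cs)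

  first-A : ∀ {T P l X} acc s r i cs →
    (∀ s′ r′ i′ cs′ → s′ ∷ r′ ≡ map bit acc ʳ++ s ∷ r → i′ ∷ cs′ ≡ double acc (i ∷ cs) →
      Decides T P (at (inj₂ (start , true)) (tape (blank ∷ l) s′ r′) (move blank ▸ X)
        (tape [] i′ cs′ ∷ others))) →
    Decides (length acc * 3 + suc T) P
      (at (inj₁ (first true)) (behindA l acc s r) X (tape [] i cs ∷ others))
  first-A []            s r i cs D = run refl (D s r i cs refl refl)
  first-A (false ∷ acc) s r i cs D = run refl (run refl (run refl (first-A acc _ _ _ _ D)))
  first-A (true ∷ acc)  s r i cs D = run refl (run refl (run refl (first-A acc _ _ _ _ D)))

  first-X : ∀ {T P A} acc s r i cs →
    (∀ s′ r′ i′ cs′ → s′ ∷ r′ ≡ map bit acc ʳ++ s ∷ r → i′ ∷ cs′ ≡ double acc (i ∷ cs) →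
      Decides T P (at (inj₂ (start , true)) (move blank ▸ A) (tape (blank ∷ []) s′ r′)
        (tape [] i′ cs′ ∷ others))) →
    Decides (length acc * 3 + suc T) P
      (at (inj₁ (first false)) A (behindX acc s r) (tape [] i cs ∷ others))
  first-X []            s r i cs D = run refl (D s r i cs refl refl)
  first-X (false ∷ acc) s r i cs D = run refl (run refl (run refl (first-X acc _ _ _ _ D)))
  first-X (true ∷ acc)  s r i cs D = run refl (run refl (run refl (first-X acc _ _ _ _ D)))

  double-pair : ∀ acc u v → double acc (map bit ⟨ u , v ⟩) ≡ map bit ⟨ acc ʳ++ u , v ⟩
  double-pair []        u v = refl
  double-pair (b ∷ acc) u v = double-pair acc (b ∷ u) v

  Spells : Tape Symbol → Str → Set
  Spells t u = Tape.head t ∷ Tape.right t ≡ map bit u ++ [ blank ]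

  spells-reverse : ∀ acc {s r} → s ∷ r ≡ map bit acc ʳ++ [ blank ] →
                   s ∷ r ≡ map bit (acc ʳ++ []) ++ [ blank ]
  spells-reverse acc eq = trans eq (prefixed acc [])
    where
    prefixed : ∀ acc u → map bit acc ʳ++ (map bit u ++ [ blank ]) ≡ map bit (acc ʳ++ u) ++ [ blank ]
    prefixed []        u = refl
    prefixed (b ∷ acc) u = prefixed acc (b ∷ u)

  inputTape-spell : ∀ u → inputTape u ≡ spell [] (map bit u)
  inputTape-spell []      = refl
  inputTape-spell (_ ∷ _) = refl

  -- The tape must equal the input tape as a data structure, without stray blanks, for the
  -- simulation to start in `M.initial`.
  written : ∀ uacc vacc {i cs} →
    i ∷ cs ≡ double uacc (bit false ∷ bit true ∷ (map bit vacc ʳ++ [])) →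
    tape [] i cs ≡ inputTape ⟨ uacc ʳ++ [] , vacc ʳ++ [] ⟩
  written uacc vacc {i} {cs} eq = begin
    tape [] i cs                                                  ≡⟨ cong (spell []) eq ⟩
    spell [] (double uacc (bit false ∷ bit true ∷ (map bit vacc ʳ++ [])))
      ≡⟨ cong (λ cs → spell [] (double uacc (bit false ∷ bit true ∷ cs))) (sym (map-ʳ++ bit vacc)) ⟩
    spell [] (double uacc (map bit ⟨ [] , vacc ʳ++ [] ⟩))         ≡⟨ cong (spell []) (double-pair uacc [] _) ⟩
    spell [] (map bit ⟨ uacc ʳ++ [] , vacc ʳ++ [] ⟩)              ≡⟨ sym (inputTape-spell ⟨ uacc ʳ++ [] , vacc ʳ++ [] ⟩) ⟩
    inputTape ⟨ uacc ʳ++ [] , vacc ʳ++ [] ⟩                       ∎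
    where open ≡-Reasoning

  onI : ∀ {T P p A X I I′} → I ≡ I′ → Decides T P (at p A X (I′ ∷ others)) → Decides T P (at p A X (I ∷ others))
  onI refl D = D

  -- A bit of the second component costs one step and a bit of the first three. Charging three for
  -- every bit gives one bound for both orders.
  build : ∀ {T P} c xacc wacc l →
    (∀ A X → Spells A (wacc ʳ++ []) → Spells X (xacc ʳ++ []) →
      Decides T P (at (inj₂ (start , true)) A X (inputTape (query c (xacc ʳ++ []) (wacc ʳ++ [])) ∷ others))) →
    Decides (3 * (length xacc + length wacc) + (3 + T)) P
      (at (inj₁ (second c)) (behindA l wacc blank []) (behindX xacc blank []) (blankTape ∷ others))
  build {T} false xacc wacc l D =
    weaken (slack (length xacc) (length wacc) T)
      (second-A wacc blank [] [] λ s r eqA → run refl (first-X xacc blank [] _ _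
        λ s′ r′ i cs eqX eqI → onI (written xacc wacc eqI) (D _ _ (spells-reverse wacc eqA) (spells-reverse xacc eqX))))
    where
    slack : ∀ m n T → n + suc (suc (m * 3 + suc T)) ≤ 3 * (m + n) + (3 + T)
    slack m n T = ≤-trans (m≤m+n _ (2 * n)) (≤-reflexive (rearrange m n T))
      where
      rearrange : ∀ m n T → n + suc (suc (m * 3 + suc T)) + 2 * n ≡ 3 * (m + n) + (3 + T)
      rearrange = solve-∀
  build {T} true xacc wacc l D =
    weaken (slack (length xacc) (length wacc) T)
      (second-X xacc blank [] [] λ s r eqX → run refl (first-A wacc blank [] _ _
        λ s′ r′ i cs eqA eqI → onI (written wacc xacc eqI) (D _ _ (spells-reverse wacc eqA) (spells-reverse xacc eqX))))
    where
    slack : ∀ m n T → m + suc (suc (n * 3 + suc T)) ≤ 3 * (m + n) + (3 + T)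
    slack m n T = ≤-trans (m≤m+n _ (2 * m)) (≤-reflexive (rearrange m n T))
      where
      rearrange : ∀ m n T → m + suc (suc (n * 3 + suc T)) + 2 * m ≡ 3 * (m + n) + (3 + T)
      rearrange = solve-∀

  -- Simulating the given machine

  simulate⁻ : ∀ {q g a x ss b} → b ∈ˡ δ′ (inj₂ (q , g)) (a ∷ x ∷ ss) →
    (q ≡ accept × agrees g (read a x) ≡ target × b ≡ finished a x ss) ⊎
    (q ≢ accept × ∃[ c ] c ∈ˡ δ q ss × b ≡ lift g a x c)
  simulate⁻ {q} {g} {a} {x} b∈ with q Fin.≟ accept
  simulate⁻ {q} {g} {a} {x} b∈ | no q≢ = inj₂ (q≢ , ∈-map⁻ (lift g a x) b∈)
  simulate⁻ {q} {g} {a} {x} b∈ | yes q≡ with agrees g (read a x) Bool.≟ target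
  simulate⁻ (here b≡) | yes q≡ | yes agree = inj₁ (q≡ , agree , b≡)

  finish⁺ : ∀ {q g a x ss} → q ≡ accept → agrees g (read a x) ≡ target →
            finished a x ss ∈ˡ δ′ (inj₂ (q , g)) (a ∷ x ∷ ss)
  finish⁺ {q} {g} {a} {x} q≡ agree with q Fin.≟ accept
  ... | no q≢ = contradiction q≡ q≢
  ... | yes _ with agrees g (read a x) Bool.≟ target
  ...   | yes _     = here refl
  ...   | no  ¬agree = contradiction agree ¬agree

  lift⁺ : ∀ {q g a x ss c} → q ≢ accept → c ∈ˡ δ q ss → lift g a x c ∈ˡ δ′ (inj₂ (q , g)) (a ∷ x ∷ ss)
  lift⁺ {q} q≢ c∈ with q Fin.≟ accept
  ... | yes q≡ = contradiction q≡ q≢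
  ... | no  _  = ∈-map⁺ _ c∈

  referenceTape : Tape Symbol → Tape Symbol → Tape Symbol
  referenceTape A X = if advised then A else X

  module Simulation (ref : Str) where

    -- The invariant of the simulation. Divergence excludes every continuation of the output, so it
    -- survives further output.
    data Tracks (t : Tape Symbol) (o : Str) : Bool → Set where
      matching : ∀ r → Spells t r → o ++ r ≡ ref → Tracks t o true
      diverged : (∀ r → o ++ r ≢ ref) → Tracks t o false

    tracks-compare : ∀ {t o g} e → Tracks t o g →
      Tracks (move blank (proj₂ (compare g (Tape.head t) e)) t) (o ++ fromMaybe e)
             (proj₁ (compare g (Tape.head t) e))
    tracks-compare {o = o} nothing (matching r spells eq) rewrite ++-identityʳ o = matching r spells eq
    tracks-compare {o = o} nothing (diverged ≢ref)        rewrite ++-identityʳ o = diverged ≢ref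
    tracks-compare {o = o} (just b) (diverged ≢ref) = diverged λ r eq → ≢ref _ (trans (sym (++-assoc o _ r)) eq)
    -- The reference is used up, so one more bit makes the output too long.
    tracks-compare {o = o} (just b) (matching [] refl eq) = diverged λ r eq′ →
      contradiction (++-cancelˡ o _ _ (trans (sym (++-assoc o _ r)) (trans eq′ (sym eq)))) λ ()
    tracks-compare {t} {o} (just b) (matching (b′ ∷ r) spells eq) = bits b b′ spells eq
      where
      advanced : ∀ l s r → Spells (move blank ▸ (tape l s (map bit r ++ [ blank ]))) r
      advanced l s []      = refl
      advanced l s (_ ∷ r) = refl
      differ : ∀ b b′ → b ≢ b′ → o ++ b′ ∷ r ≡ ref → ∀ r′ → (o ++ [ b ]) ++ r′ ≢ ref
      differ b b′ b≢ eq r′ eq′ with ++-cancelˡ o _ _ (trans (sym (++-assoc o _ r′)) (trans eq′ (sym eq)))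
      ... | refl = b≢ refl
      bits : ∀ b b′ {l s rs} → s ∷ rs ≡ map bit (b′ ∷ r) ++ [ blank ] → o ++ b′ ∷ r ≡ ref →
             Tracks (move blank (proj₂ (compare true s (just b))) (tape l s rs)) (o ++ [ b ])
                    (proj₁ (compare true s (just b)))
      bits false false refl eq = matching r (advanced _ _ r) (trans (++-assoc o _ r) eq)
      bits true  true  refl eq = matching r (advanced _ _ r) (trans (++-assoc o _ r) eq)
      bits false true  refl eq = diverged (differ false true (λ ()) eq)
      bits true  false refl eq = diverged (differ true false (λ ()) eq)

    tracks-agrees : ∀ {t o g} → Tracks t o g → agrees g (Tape.head t) ≡ does (o ≟ˢ ref)
    tracks-agrees {o = o} (matching [] refl eq) =
      sym (dec-true (o ≟ˢ ref) (trans (sym (++-identityʳ o)) eq))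
    tracks-agrees {o = o} (matching (b ∷ r) spells eq) =
      trans (bits b spells) (sym (dec-false (o ≟ˢ ref)
        λ eq′ → contradiction (++-cancelˡ o _ _ (trans eq (trans (sym eq′) (sym (++-identityʳ o))))) λ ()))
      where
      bits : ∀ {s rs} b → s ∷ rs ≡ map bit (b ∷ r) ++ [ blank ] → agrees true s ≡ false
      bits false refl = refl
      bits true  refl = refl
    tracks-agrees {o = o} (diverged ≢ref) =
      sym (dec-false (o ≟ˢ ref) λ eq → ≢ref [] (trans (++-identityʳ o) eq))

    read-head : ∀ A X → read (Tape.head A) (Tape.head X) ≡ Tape.head (referenceTape A X)
    read-head A X = sym (Bool.if-float Tape.head advised)

    move-selected : ∀ β m A X →
      (if β then move blank (if β then m else stay) A else move blank (if β then stay else m) X) ≡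
      move blank m (if β then A else X)
    move-selected false m A X = refl
    move-selected true  m A X = refl

    agrees-output : ∀ {A X g o} → Tracks (referenceTape A X) o g →
      agrees g (read (Tape.head A) (Tape.head X)) ≡ does (o ≟ˢ ref)
    agrees-output {A} {X} {g} T = trans (cong (agrees g) (read-head A X)) (tracks-agrees T)

    tracks-lift : ∀ {A X o g} e → Tracks (referenceTape A X) o g →
      let next = compare g (read (Tape.head A) (Tape.head X)) e in
      Tracks (referenceTape (move blank (if advised then proj₂ next else stay) A)
                            (move blank (if advised then stay else proj₂ next) X))
             (o ++ fromMaybe e) (proj₁ next)
    tracks-lift {A} {X} {o} {g} e T =
      subst (λ t → Tracks t (o ++ fromMaybe e) (proj₁ (compare g (read (Tape.head A) (Tape.head X)) e)))
          (sym (move-selected advised _ A X))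
        (subst (λ s → Tracks (move blank (proj₂ (compare g s e)) (referenceTape A X)) (o ++ fromMaybe e)
                             (proj₁ (compare g s e)))
          (sym (read-head A X)) (tracks-compare e T))

    -- The simulation goes step for step; the one extra step enters `accepting`. Paths that do not
    -- accept are covered too, since they also count for the time bound.
    project : ∀ {q g A X ts o t d} → Tracks (referenceTape A X) o g → Path (at (inj₂ (q , g)) A X ts) t d →
      ∃₂ λ t′ d′ → M.Path (M.config q ts o) t′ d′ × t ≤ suc t′ ×
        (J.Config.state d ≡ encode (inj₁ accepting) →
          M.Config.state d′ ≡ accept × does (M.Config.output d′ ≟ˢ ref) ≡ target)
    project T done = 0 , _ , M.done , z≤n , λ eq → contradiction (encode-injective eq) λ ()
    project {q} {g} T (step b _ b∈ π) with ∈-map⁻ relabel (subst (b ∈ˡ_) (δ-at (inj₂ (q , g))) b∈)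
    ... | _ , b∈′ , refl with simulate⁻ {q} {g} b∈′
    project T (step b _ b∈ done) | _ , b∈′ , refl | inj₁ (q≡ , agree , refl) =
      0 , _ , M.done , s≤s z≤n , λ _ → q≡ , trans (sym (agrees-output T)) agree
    project T (step b _ b∈ (step _ ≢accepting _ _)) | _ , b∈′ , refl | inj₁ (q≡ , agree , refl) =
      contradiction refl ≢accepting
    project T (step b _ b∈ π) | _ , b∈′ , refl | inj₂ (q≢ , action q′ ss ms e , c∈ , refl) =
      let t′ , d′ , π′ , t≤ , acc = project (tracks-lift e T) π
      in suc t′ , d′ , M.step (action q′ ss ms e) q≢ c∈ π′ , s≤s t≤ , acc

    embed : ∀ {q g A X ts o t d} → Tracks (referenceTape A X) o g → M.Path (M.config q ts o) t d →
      M.Config.state d ≡ accept → does (M.Config.output d ≟ˢ ref) ≡ target →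
      AcceptsFrom (at (inj₂ (q , g)) A X ts)
    embed {q} {g} T M.done q≡ agree =
      1 , _ , step _ ((λ ()) ∘ encode-injective)
        (subst (_ ∈ˡ_) (sym (δ-at (inj₂ (q , g))))
          (∈-map⁺ relabel (finish⁺ {q} {g} q≡ (trans (agrees-output T) agree)))) done , refl
    embed {q} {g} T (M.step (action q′ ss ms e) q≢ c∈ π) q≡ agree =
      let t , d , π′ , acc = embed (tracks-lift e T) π q≡ agree
      in suc t , d , step _ ((λ ()) ∘ encode-injective)
           (subst (_ ∈ˡ_) (sym (δ-at (inj₂ (q , g)))) (∈-map⁺ relabel (lift⁺ {q} {g} q≢ c∈))) π′ , acc

  simulation-decides : ∀ {B A X} c x w → Spells A w → Spells X x →
    (∀ {t d} → M.Path (M.initial (query c x w)) t d → t ≤ B) →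
    Decides (suc B) (Judged x c w false target)
      (at (inj₂ (start , true)) A X (inputTape (query c x w) ∷ others))
  simulation-decides {A = A} {X} c x w A-spells X-spells bounded = record
    { time     = λ π → let _ , _ , π′ , t≤ , _ = project tracks π in ≤-trans t≤ (s≤s (bounded π′))
    ; sound    = λ (_ , _ , π , acc) →
        let t′ , d′ , π′ , _ , accepted = project tracks π
        in M.Config.output d′ , (t′ , d′ , π′ , proj₁ (accepted acc) , refl) , proj₂ (accepted acc)
    ; complete = λ { (_ , (_ , _ , π , q≡ , refl) , agree) → embed tracks π q≡ agree }
    }
    where
    open Simulation (reference x w)
    tracks : Tracks (referenceTape A X) [] true
    tracks = matching (reference x w) (selected advised) refl
      where
      selected : ∀ β → Spells (if β then A else X) (if β then w else x)
      selected false = X-spells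
      selected true  = A-spells

  -- Scanning the advice

  advice-decides : ∀ {B} c u acc s xacc l →
    (∀ {t d} → M.Path (M.initial (query c (xacc ʳ++ []) (acc ʳ++ s))) t d → t ≤ B) →
    Decides (length s + suc (3 * (length xacc + (length acc + length s)) + (4 + B)))
      (Judged (xacc ʳ++ []) c (acc ʳ++ s) (u ∧ constant c s) target)
      (at (inj₁ (advice c u)) (spell (map bit acc ++ blank ∷ l) (map bit s))
        (tape (map bit xacc) blank []) (blankTape ∷ others))
  advice-decides {B} c true  acc [] xacc l bounded = weaken (s≤s z≤n) (verdict c (λ ()) refl)
  advice-decides {B} c false acc [] xacc l bounded =
    weaken (s≤s (≤-reflexive (rearrange (length xacc) (length acc) B)))
      (run refl (build c xacc acc l λ A X A-spells X-spells → simulation-decides c _ _ A-spells X-spells bounded))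
    where
    rearrange : ∀ m n B → 3 * (m + n) + (3 + (1 + B)) ≡ 3 * (m + (n + 0)) + (4 + B)
    rearrange = solve-∀
  advice-decides {B} c u acc (b ∷ s) xacc l bounded = advance b bounded
    where
    rearrange : ∀ a m n B → n + (1 + (3 * (a + (1 + m + n)) + (4 + B))) ≡
                            n + (1 + (3 * (a + (m + (1 + n))) + (4 + B)))
    rearrange = solve-∀
    advance : ∀ b → (∀ {t d} → M.Path (M.initial (query c (xacc ʳ++ []) (acc ʳ++ b ∷ s))) t d → t ≤ B) →
      Decides (suc (length s) + suc (3 * (length xacc + (length acc + suc (length s))) + (4 + B)))
        (Judged (xacc ʳ++ []) c (acc ʳ++ b ∷ s) (u ∧ (sameBit b c ∧ constant c s)) target)
        (at (inj₁ (advice c u)) (tape (map bit acc ++ blank ∷ l) (bit b) (map bit s))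
          (tape (map bit xacc) blank []) (blankTape ∷ others))
    advance false bounded = weaken (s≤s (≤-reflexive (rearrange (length xacc) (length acc) (length s) B)))
      (run refl (onA (move-▸ _ _ _)
        -- `u` is the verdict on the part already read, so its conjunction with the constancy of the
        -- unread part is invariant.
        (onGoal (cong (λ β → Judged _ c _ β target) (Bool.∧-assoc u _ _))
          (advice-decides c (u ∧ sameBit false c) (false ∷ acc) s xacc l bounded))))
    advance true bounded = weaken (s≤s (≤-reflexive (rearrange (length xacc) (length acc) (length s) B)))
      (run refl (onA (move-▸ _ _ _)
        (onGoal (cong (λ β → Judged _ c _ β target) (Bool.∧-assoc u _ _))
          (advice-decides c (u ∧ sameBit true c) (true ∷ acc) s xacc l bounded))))

  -- Parsing and the time bound

  length-pair : ∀ u v → length ⟨ u , v ⟩ ≡ 2 * length u + (2 + length v)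
  length-pair []      v = refl
  length-pair (_ ∷ u) v rewrite length-pair u v = rearrange (length u) (length v)
    where
    rearrange : ∀ m n → 2 + (2 * m + (2 + n)) ≡ 2 * suc m + (2 + n)
    rearrange = solve-∀

  -- Exchanging the components doubles `w` instead of `x`, so the query may be longer than the
  -- input, but at most by a factor of two. The 3 counts delimiter and flag.
  length-query : ∀ c x w → length (query c x w) ≤ 2 * (length x + (3 + length w))
  length-query false x w rewrite length-pair x w =
    ≤-trans (m≤m+n _ (4 + length w)) (≤-reflexive (rearrange (length x) (length w)))
    where
    rearrange : ∀ m n → 2 * m + (2 + n) + (4 + n) ≡ 2 * (m + (3 + n))
    rearrange = solve-∀
  length-query true x w rewrite length-pair w x =
    ≤-trans (m≤m+n _ (4 + length x)) (≤-reflexive (rearrange (length x) (length w)))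
    where
    rearrange : ∀ m n → 2 * n + (2 + m) + (4 + m) ≡ 2 * (m + (3 + n))
    rearrange = solve-∀

  module _ (p : Polynomial) (bounded : ∀ u {t d} → M.Path (M.initial u) t d → t ≤ eval p (length u)) where

    -- The linear term pays for parsing, scanning and writing: a bit of advice is scanned once and
    -- costs at most three steps to write. The last term pays for the simulation on a query of
    -- length at most `2 * m`.
    bound : ℕ → ℕ
    bound m = 7 + 4 * m + eval p (2 * m)

    bound-suc : ∀ m → 2 + bound m ≤ bound (suc m)
    bound-suc m = +-mono-≤ (s≤s (s≤s (s≤s (s≤s (s≤s (s≤s (s≤s linear)))))))
                           (eval-mono p (*-monoʳ-≤ 2 (n≤1+n m)))
      where
      linear : 2 + 4 * m ≤ 4 * suc m
      linear = ≤-trans (m≤m+n _ 2) (≤-reflexive (rearrange m))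
        where
        rearrange : ∀ m → 2 + 4 * m + 2 ≡ 4 * suc m
        rearrange = solve-∀

    -- Parsing a doubled bit takes two steps and turns two input cells into one cell of X, so the
    -- measure drops by one.
    bound-double : ∀ a n → 2 + bound (suc a + n) ≤ bound (a + (2 + n))
    bound-double a n = subst (λ m → 2 + bound (suc a + n) ≤ bound m)
      (sym (trans (+-suc a (suc n)) (cong suc (+-suc a n)))) (bound-suc (suc a + n))

    parse-decides : ∀ xacc s l →
      Decides (bound (length xacc + length s)) (VerdictFrom xacc s target)
        (at (inj₁ parse₁) (spell l (map bit s)) (tape (map bit xacc) blank []) (blankTape ∷ others))
    parse-decides xacc []           l = weaken (s≤s z≤n) (verdict false (λ ()) refl)
    parse-decides xacc (false ∷ []) l = weaken (s≤s (s≤s z≤n)) (run refl (verdict false (λ ()) refl))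
    parse-decides xacc (true ∷ [])  l = weaken (s≤s (s≤s z≤n)) (run refl (verdict false (λ ()) refl))
    parse-decides xacc (true ∷ false ∷ s) l = weaken (s≤s (s≤s z≤n)) (run refl (verdict false (λ ()) refl))
    parse-decides xacc (false ∷ true ∷ []) l =
      weaken (s≤s (s≤s (s≤s z≤n))) (run refl (run refl (verdict false (λ ()) refl)))
    parse-decides xacc (false ∷ false ∷ s) l =
      weaken (bound-double (length xacc) (length s))
        (run refl (run refl (onA (move-▸ _ _ _) (parse-decides (false ∷ xacc) s _))))
    parse-decides xacc (true ∷ true ∷ s) l =
      weaken (bound-double (length xacc) (length s))
        (run refl (run refl (onA (move-▸ _ _ _) (parse-decides (true ∷ xacc) s _))))
    parse-decides xacc (false ∷ true ∷ c ∷ w) l = judged c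
      where
      m = length xacc + (3 + length w)
      rearrange : ∀ a n B → 3 + (n + suc (3 * (a + n) + (4 + B))) + (11 + a) ≡ 7 + 4 * (a + (3 + n)) + B
      rearrange = solve-∀
      query-bounded : ∀ c {t d} → M.Path (M.initial (query c (xacc ʳ++ []) w)) t d → t ≤ eval p (2 * m)
      query-bounded c π = ≤-trans (bounded _ π) (eval-mono p (≤-trans (length-query c (xacc ʳ++ []) w)
        (≤-reflexive (cong (λ n → 2 * (n + (3 + length w)))
          (trans (length-ʳ++ xacc) (+-identityʳ (length xacc)))))))
      judged : ∀ c → Decides (bound m) (Judged (xacc ʳ++ []) c w (constant c w) target)
        (at (inj₁ parse₁) (spell l (map bit (false ∷ true ∷ c ∷ w))) (tape (map bit xacc) blank [])
          (blankTape ∷ others))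
      judged false = weaken (≤-trans (m≤m+n _ (11 + length xacc)) (≤-reflexive (rearrange (length xacc) (length w) _)))
        (run refl (run refl (run refl (onA (move-▸ _ _ _)
          (advice-decides false true [] w xacc _ (query-bounded false))))))
      judged true = weaken (≤-trans (m≤m+n _ (11 + length xacc)) (≤-reflexive (rearrange (length xacc) (length w) _)))
        (run refl (run refl (run refl (onA (move-▸ _ _ _)
          (advice-decides true true [] w xacc _ (query-bounded true))))))

    initial-decides : ∀ s → Decides (bound (length s)) (Verdict s target) (J.initial s)
    initial-decides s = onA (inputTape-judge s) (parse-decides [] s [])
      where
      bit-judge : ∀ b → J.bit b ≡ bit b
      bit-judge false = refl
      bit-judge true  = refl
      inputTape-judge : ∀ s → J.inputTape s ≡ spell [] (map bit s)
      inputTape-judge []      = refl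
      inputTape-judge (b ∷ s) = cong₂ (tape []) (bit-judge b) (map-cong bit-judge s)

    boundPolynomial : Polynomial
    boundPolynomial = (7 ∷ 4 ∷ []) ⊕ dilate p

    eval-boundPolynomial : ∀ m → eval boundPolynomial m ≡ bound m
    eval-boundPolynomial m
      rewrite eval-⊕ (7 ∷ 4 ∷ []) (dilate p) m | eval-dilate p m = rearrange m (eval p (2 * m))
      where
      rearrange : ∀ m e → 7 + m * (4 + m * 0) + e ≡ 7 + 4 * m + e
      rearrange = solve-∀

verdict-NP : ∀ M advised target → Computation.PolynomialTime M →
             NP (λ s → Verdict.Verdict M advised s target)
verdict-NP M advised target (p , bounded) =
  judge , (boundPolynomial p bounded ,
           λ s {t} π → subst (t ≤_) (sym (eval-boundPolynomial p bounded (length s)))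
                         (initial-decides p bounded s .time π)) ,
  λ s → mk⇔ (initial-decides p bounded s .complete) (initial-decides p bounded s .sound)
  where
  open Judge M advised target
  open Decides

-- Advice from a selector

strings : ℕ → List Str
strings zero    = [ [] ]
strings (suc n) = map (false ∷_) (strings n) ++ map (true ∷_) (strings n)

∈-strings : ∀ x → x ∈ˡ strings (length x)
∈-strings []          = here refl
∈-strings (false ∷ x) = ∈-++⁺ˡ (∈-map⁺ (false ∷_) (∈-strings x))
∈-strings (true ∷ x)  = ∈-++⁺ʳ (map (false ∷_) (strings (length x))) (∈-map⁺ (true ∷_) (∈-strings x))

constant-replicate : ∀ c n → constant c (replicate n c) ≡ true
constant-replicate c     zero    = refl
constant-replicate false (suc n) = constant-replicate false n
constant-replicate true  (suc n) = constant-replicate true n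

constant⇒replicate : ∀ c w → constant c w ≡ true → w ≡ replicate (length w) c
constant⇒replicate c     []          eq = refl
constant⇒replicate false (false ∷ w) eq = cong (false ∷_) (constant⇒replicate false w eq)
constant⇒replicate true  (true ∷ w)  eq = cong (true ∷_) (constant⇒replicate true w eq)

NP-resp-⇔ : ∀ {A A′ : Language} → (∀ s → A s ⇔ A′ s) → NP A → NP A′
NP-resp-⇔ A⇔A′ (M , poly , A⇔M) = M , poly , λ s → mk⇔
  (λ s∈ → Equivalence.to (A⇔M s) (Equivalence.from (A⇔A′ s) s∈))
  (λ acc → Equivalence.to (A⇔A′ s) (Equivalence.from (A⇔M s) acc))

-- Complementing the verdict

module _ {M : NTM} {advised : Bool} where

  open Computation M using (Outputs)
  open Verdict M advised

  module _ (defined : ∀ x y → ∃ (Outputs ⟨ x , y ⟩))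
           (functional : ∀ x y {o o′} → Outputs ⟨ x , y ⟩ o → Outputs ⟨ x , y ⟩ o′ → o ≡ o′) where

    defined-query : ∀ c x w → ∃ (Outputs (query c x w))
    defined-query false x w = defined x w
    defined-query true  x w = defined w x

    functional-query : ∀ c x w {o o′} → Outputs (query c x w) o → Outputs (query c x w) o′ → o ≡ o′
    functional-query false x w = functional x w
    functional-query true  x w = functional w x

    constant-complement : ∀ c → c ≡ false ⇔ (¬ c ≡ true)
    constant-complement false = mk⇔ (λ _ ()) (λ _ → refl)
    constant-complement true  = mk⇔ (λ ()) (λ ≢true → contradiction refl ≢true)

    -- Single-valuedness excludes two opposite verdicts; totality supplies an output to witness the
    -- negative one.
    judged-complement : ∀ x c w u → Judged x c w u false ⇔ (¬ Judged x c w u true)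
    judged-complement x c w true  = constant-complement c
    judged-complement x c w false = mk⇔
      (λ (o , out , eq) (o′ , out′ , eq′) → contradiction
        (trans (sym eq) (trans (cong (λ o → does (o ≟ˢ reference x w)) (functional-query c x w out out′)) eq′)) λ ())
      (λ ¬accepted → let o , out = defined-query c x w
                     in o , out , Equivalence.from (constant-complement _) λ eq → ¬accepted (o , out , eq))

    verdictFrom-complement : ∀ acc s → VerdictFrom acc s false ⇔ (¬ VerdictFrom acc s true)
    verdictFrom-complement acc (false ∷ false ∷ s)    = verdictFrom-complement (false ∷ acc) s
    verdictFrom-complement acc (true ∷ true ∷ s)      = verdictFrom-complement (true ∷ acc) s
    verdictFrom-complement acc (false ∷ true ∷ c ∷ w) = judged-complement (acc ʳ++ []) c w (constant c w)
    verdictFrom-complement acc (false ∷ true ∷ [])    = constant-complement false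
    verdictFrom-complement acc (true ∷ false ∷ s)     = constant-complement false
    verdictFrom-complement acc (false ∷ [])           = constant-complement false
    verdictFrom-complement acc (true ∷ [])            = constant-complement false
    verdictFrom-complement acc []                     = constant-complement false

    -- The complement is accepted by the same construction with `target` set to `false`.
    verdict-NP∩coNP : Computation.PolynomialTime M → (NP ∩ coNP) (λ s → Verdict s true)
    verdict-NP∩coNP poly =
      verdict-NP M advised true poly ,
      NP-resp-⇔ (verdictFrom-complement []) (verdict-NP M advised false poly)

  constant-verdict : ∀ x c n v → Verdict ⟨ x , c ∷ replicate n c ⟩ v ≡ (c ≡ v)
  constant-verdict x c n v =
    trans (verdict-pair x c _ v) (cong (λ u → Judged x c (replicate n c) u v) (constant-replicate c n))

  query-verdict : ∀ x c w v → w ≢ replicate (length w) c →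
    Verdict ⟨ x , c ∷ w ⟩ v ≡ (∃[ o ] Outputs (query c x w) o × does (o ≟ˢ reference x w) ≡ v)
  query-verdict x c w v ≢rep with constant c w in eq
  ... | true  = contradiction (constant⇒replicate c w eq) ≢rep
  ... | false = trans (verdict-pair x c w v) (cong (λ u → Judged x c w u v) eq)

-- Extremal elements and a uniform order of the arguments

module Extremal (em : ExcludedMiddle 0ℓ) (U : Pred Str 0ℓ) (_≽_ : Str → Str → Set)
  (total : ∀ {a b} → U a → U b → a ≽ b ⊎ b ≽ a)
  (≽-trans : ∀ {a b c} → U a → U b → U c → a ≽ b → b ≽ c → a ≽ c) where

  least : Satisfiable U → ∀ xs → ∃[ m ] U m × (∀ {x} → x ∈ˡ xs → U x → x ≽ m)
  least (a , Ua) []       = a , Ua , λ ()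
  least ne       (y ∷ xs) with least ne xs | em {U y}
  ... | m , Um , x≽m | no ¬Uy = m , Um , λ
    { (here refl) Ux → contradiction Ux ¬Uy ; (there x∈) Ux → x≽m x∈ Ux }
  ... | m , Um , x≽m | yes Uy with total Uy Um
  ...   | inj₁ y≽m = m , Um , λ { (here refl) _ → y≽m ; (there x∈) Ux → x≽m x∈ Ux }
  ...   | inj₂ m≽y = y , Uy , λ
    { (here refl) Ux → [ id , id ]′ (total Ux Ux)
    ; (there x∈) Ux  → ≽-trans Ux Um Uy (x≽m x∈ Ux) m≽y }

-- L x w and R w x are the two ways in which x may beat w, depending on the order of the
-- arguments of the selector.  One order works for all x at once; the strings s c are reserved
-- for other purposes, and an equivalent element is used instead if w is reserved.
module OneSided (em : ExcludedMiddle 0ℓ) (U : Pred Str 0ℓ) (L R : Str → Str → Set)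
  (L-refl : ∀ {a} → U a → L a a) (R-refl : ∀ {a} → U a → R a a)
  (L-trans : ∀ {a b c} → U a → U b → U c → L a b → L b c → L a c)
  (R-trans : ∀ {a b c} → U a → U b → U c → R a b → R b c → R a c)
  (total : ∀ {a b} → U a → U b → L a b ⊎ R a b) where

  Beats : Bool → Str → Str → Set
  Beats false w x = L x w
  Beats true  w x = R w x

  ¬L⇒R : ∀ {a b} → U a → U b → ¬ L a b → R a b
  ¬L⇒R Ua Ub ¬L = [ (λ l → contradiction l ¬L) , id ]′ (total Ua Ub)

  ¬R⇒L : ∀ {a b} → U a → U b → ¬ R a b → L a b
  ¬R⇒L Ua Ub ¬R = [ id , (λ r → contradiction r ¬R) ]′ (total Ua Ub)

  counterexample : ∀ {P : Str → Set} → ¬ (∀ x → U x → P x) → ∃[ x ] U x × ¬ P x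
  counterexample {P} ¬all with em {∃[ x ] U x × ¬ P x}
  ... | yes ce = ce
  ... | no ¬ce = contradiction (λ x Ux → decidable-stable em λ ¬Px → ¬ce (x , Ux , ¬Px)) ¬all

  oneSided : ∀ {w} → U w → (∀ x → U x → L x w ⊎ R w x) → (s : Bool → Str) → s false ≢ s true →
    ∃₂ λ c v → U v × v ≢ s c × (∀ x → U x → Beats c v x)
  oneSided {w} Uw beaten s s≢s with em {∀ x → U x → L x w}
  ... | yes l with w ≟ˢ s false
  ...   | no  w≢ = false , w , Uw , w≢ , l
  ...   | yes refl with em {∀ x → U x → R w x}
  ...     | yes r = true , w , Uw , s≢s , r
  ...     | no ¬r with counterexample ¬r
  -- Here `w` is reserved for this order. From `¬ R w y` follows `L w y`, so `y` takes the place of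
  -- `w`; it differs from `w` because `R w w` holds.
  ...       | y , Uy , ¬Rwy = false , y , Uy , (λ { refl → ¬Rwy (R-refl Uw) }) ,
                λ x Ux → L-trans Ux Uw Uy (l x Ux) (¬R⇒L Uw Uy ¬Rwy)
  oneSided {w} Uw beaten s s≢s | no ¬l with counterexample ¬l
  ... | x , Ux , ¬Lxw = pick (w ≟ˢ s true)
    where
    Rwx : R w x
    Rwx = [ (λ l → contradiction l ¬Lxw) , id ]′ (beaten x Ux)

    -- If `R w y` failed, then `L y w`. Comparing `x` with `y` then gives `L x w` through `y`, or
    -- `R w y` through `x`, and both are excluded.
    Rw : ∀ y → U y → R w y
    Rw y Uy = decidable-stable em λ ¬Rwy →
      let Lyw = [ id , (λ r → contradiction r ¬Rwy) ]′ (beaten y Uy)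
      in [ (λ Lxy → ¬Lxw (L-trans Ux Uy Uw Lxy Lyw)) , (λ Rxy → ¬Rwy (R-trans Uw Ux Uy Rwx Rxy)) ]′ (total Ux Uy)

    pick : Dec (w ≡ s true) → ∃₂ λ c v → U v × v ≢ s c × (∀ x → U x → Beats c v x)
    pick (no w≢)    = true , w , Uw , w≢ , Rw
    -- Again a replacement: `¬ L x w` gives `R x w`, and it separates `x` from `w`.
    pick (yes refl) = true , x , Ux , (λ { refl → ¬Lxw (L-refl Uw) }) ,
      λ y Uy → R-trans Ux Uw Uy (¬L⇒R Ux Uw ¬Lxw) (Rw y Uy)

-- The preorder of an associative selector

ordered : MVFun → Bool → Str → Str → Pred Str 0ℓ
ordered f false x w = f x w
ordered f true  x w = f w x

module Selection (em : ExcludedMiddle 0ℓ) (f : MVFun) (U : Pred Str 0ℓ)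
  (selective : ∀ a b → f a b ⊆ ｛ a ｝ ∪ ｛ b ｝)
  (defined : ∀ {a b} → U a → U b → Satisfiable (f a b))
  (associative : ∀ {a b c} → U a → U b → U c → imageʳ f a (f b c) ≐ imageˡ f (f a b) c) where

  L R _≽_ : Str → Str → Set
  L a b = a ∈ f a b
  R a b = b ∈ f a b
  a ≽ b = L a b ⊎ R b a

  idempotent : ∀ {a} → U a → a ∈ f a a
  idempotent {a} Ua with defined Ua Ua
  ... | z , z∈ with selective a a z∈
  ...   | inj₁ refl = z∈
  ...   | inj₂ refl = z∈

  selects : ∀ {a b} → U a → U b → L a b ⊎ R a b
  selects {a} {b} Ua Ub with defined Ua Ub
  ... | z , z∈ with selective a b z∈
  ...   | inj₁ refl = inj₁ z∈
  ...   | inj₂ refl = inj₂ z∈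

  -- By hypothesis `a` is a value of a(bc), hence of (ab)c, say of tc with `t` among `a` and `b`. If
  -- `t` is `b`, then `a` is a value of bc and equals `b` or `c`.
  L-trans : ∀ {a b c} → U a → U b → U c → L a b → L b c → L a c
  L-trans {a} {b} {c} Ua Ub Uc a∈ab b∈bc with proj₁ (associative Ua Ub Uc) (b , b∈bc , a∈ab)
  ... | t , t∈ab , a∈tc with selective a b t∈ab
  ...   | inj₁ refl = a∈tc
  ...   | inj₂ refl with selective b c a∈tc
  ...     | inj₁ refl = b∈bc
  ...     | inj₂ refl = idempotent Ua

  R-trans : ∀ {a b c} → U a → U b → U c → R a b → R b c → R a c
  R-trans {a} {b} {c} Ua Ub Uc b∈ab c∈bc with proj₂ (associative Ua Ub Uc) (b , b∈ab , c∈bc)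
  ... | t , t∈bc , c∈at with selective b c t∈bc
  ...   | inj₂ refl = c∈at
  ...   | inj₁ refl with selective a b c∈at
  ...     | inj₁ refl = idempotent Ua
  ...     | inj₂ refl = b∈ab

  -- In the mixed cases associativity is applied with `c` in the middle, a(cb) = (ac)b and b(ca) =
  -- (bc)a, which brings `a` and `c` together.
  ≽-trans : ∀ {a b c} → U a → U b → U c → a ≽ b → b ≽ c → a ≽ c
  ≽-trans Ua Ub Uc (inj₁ a∈ab) (inj₁ b∈bc) = inj₁ (L-trans Ua Ub Uc a∈ab b∈bc)
  ≽-trans Ua Ub Uc (inj₂ a∈ba) (inj₂ b∈cb) = inj₂ (R-trans Uc Ub Ua b∈cb a∈ba)
  ≽-trans {a} {b} {c} Ua Ub Uc (inj₁ a∈ab) (inj₂ b∈cb)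
    with proj₁ (associative Ua Uc Ub) (b , b∈cb , a∈ab)
  ... | t , t∈ac , a∈tb with selective a c t∈ac
  ...   | inj₁ refl = inj₁ t∈ac
  ...   | inj₂ refl with selective c b a∈tb
  ...     | inj₁ refl = inj₁ (idempotent Ua)
  ...     | inj₂ refl = inj₂ b∈cb
  ≽-trans {a} {b} {c} Ua Ub Uc (inj₂ a∈ba) (inj₁ b∈bc)
    with proj₂ (associative Ub Uc Ua) (b , b∈bc , a∈ba)
  ... | t , t∈ca , a∈bt with selective c a t∈ca
  ...   | inj₂ refl = inj₂ t∈ca
  ...   | inj₁ refl with selective b c a∈bt
  ...     | inj₁ refl = inj₁ b∈bc
  ...     | inj₂ refl = inj₁ (idempotent Ua)

  ≽-total : ∀ {a b} → U a → U b → a ≽ b ⊎ b ≽ a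
  ≽-total Ua Ub = [ inj₁ ∘ inj₁ , inj₂ ∘ inj₂ ]′ (selects Ua Ub)

  module _ {n} (U-length : ∀ {x} → U x → length x ≡ n) (nonempty : Satisfiable U)
           (s : Bool → Str) (s≢s : s false ≢ s true) where

    ∈-strings-U : ∀ {x} → U x → x ∈ˡ strings n
    ∈-strings-U Ux = subst (λ n → _ ∈ˡ strings n) (U-length Ux) (∈-strings _)

    weakest : ∃₂ λ c w → U w × w ≢ s c × (∀ x → U x → x ∈ ordered f c x w)
    weakest =
      let m , Um , x≽m = Extremal.least em U _≽_ ≽-total ≽-trans nonempty (strings n)
          c , w , Uw , w≢ , beats = oneSided Um (λ x Ux → x≽m (∈-strings-U Ux) Ux) s s≢s
      in c , w , Uw , w≢ , λ x Ux → convert c (beats x Ux)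
      where
      open OneSided em U L R idempotent idempotent L-trans R-trans selects
      convert : ∀ c {w x} → Beats c w x → x ∈ ordered f c x w
      convert false l = l
      convert true  r = r

    -- The dual of `weakest`: the preorder is reversed, and exchanging `L` and `R` makes the chosen
    -- element the winner while `c` keeps its meaning.
    strongest : ∃₂ λ c v → U v × v ≢ s c × (∀ x → U x → v ∈ ordered f c x v)
    strongest =
      let m , Um , m≽x = Extremal.least em U (λ a b → b ≽ a) (λ Ua Ub → ≽-total Ub Ua)
                           (λ Ua Ub Uc b≽a c≽b → ≽-trans Uc Ub Ua c≽b b≽a) nonempty (strings n)
          c , v , Uv , v≢ , beats = oneSided Um (λ x Ux → swap (m≽x (∈-strings-U Ux) Ux)) s s≢s
      in c , v , Uv , v≢ , λ x Ux → convert c (beats x Ux)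
      where
      open OneSided em U R L idempotent idempotent R-trans L-trans (λ Ua Ub → swap (selects Ua Ub))
      convert : ∀ c {v x} → Beats c v x → v ∈ ordered f c x v
      convert false r = r
      convert true  l = l

-- Advice at one length

module _ (em : ExcludedMiddle 0ℓ) (M : NTM) (advised : Bool) (Z : Language) where

  open Computation M using (Outputs)
  open Verdict M advised

  AdviceAt : ℕ → Str → Set
  AdviceAt n h = length h ≡ n + 1 × (∀ x → length x ≡ n → Z x ⇔ Verdict ⟨ x , h ⟩ true)

  -- Lengths on which `Z` is empty or full take reserved advice. Only mixed lengths need a string
  -- `w`, which must not itself be read as reserved.
  adviceAt : ∀ n →
    (∀ {x y} → length x ≡ n → length y ≡ n → Z x → ¬ Z y →
      ∃₂ λ c w → length w ≡ n × w ≢ replicate n c ×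
        (∀ x → length x ≡ n →
          Z x ⇔ (∃[ o ] Outputs (query c x w) o × does (o ≟ˢ reference x w) ≡ true))) →
    ∃ (AdviceAt n)
  adviceAt n mixed with em {∃[ x ] length x ≡ n × Z x} | em {∃[ x ] length x ≡ n × ¬ Z x}
  ... | no none | _ = false ∷ replicate n false ,
    trans (cong suc (length-replicate n)) (+-comm 1 n) , λ x x≡n → mk⇔
      (λ Zx → contradiction (x , x≡n , Zx) none)
      (λ V → contradiction (subst id (constant-verdict {M} {advised} x false n true) V) λ ())
  ... | yes _ | no none = true ∷ replicate n true ,
    trans (cong suc (length-replicate n)) (+-comm 1 n) , λ x x≡n → mk⇔
      (λ _ → subst id (sym (constant-verdict {M} {advised} x true n true)) refl)
      (λ _ → decidable-stable em λ ¬Zx → none (x , x≡n , ¬Zx))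
  ... | yes (x , x≡n , Zx) | yes (y , y≡n , ¬Zy) with mixed x≡n y≡n Zx ¬Zy
  ...   | c , w , refl , w≢ , Z⇔ = c ∷ w , +-comm 1 n , λ x x≡n →
    subst (Z x ⇔_) (sym (query-verdict {M} {advised} x c w true w≢)) (Z⇔ x x≡n)

does-true : ∀ {x y} → does (x ≟ˢ y) ≡ true → x ≡ y
does-true {x} {y} eq with x ≟ˢ y
... | yes x≡y = x≡y

replicate-injective : ∀ {n} → n ≢ 0 → replicate n false ≢ replicate n true
replicate-injective {zero}  n≢0 _  = n≢0 refl
replicate-injective {suc n} _   ()

-- The inclusions

module Inclusion (em : ExcludedMiddle 0ℓ) {B : Language} {f : MVFun} {M : NTM}
  (computes : ∀ x y z → z ∈ f x y ⇔ Computation.Outputs M ⟨ x , y ⟩ z)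
  (selector : IsSelector f B) (associative : AssociativeAtEachLength f) where

  open Equivalence

  selective : ∀ a b → f a b ⊆ ｛ a ｝ ∪ ｛ b ｝
  selective a b = proj₁ (selector a b)

  definedˡ : ∀ {a} b → B a → Satisfiable (f a b)
  definedˡ {a} b Ba = proj₁ (proj₂ (selector a b) (a , inj₁ refl , Ba))

  soundˡ : ∀ {a} b → B a → f a b ⊆ B
  soundˡ {a} b Ba = proj₂ (proj₂ (selector a b) (a , inj₁ refl , Ba))

  soundʳ : ∀ a {b} → B b → f a b ⊆ B
  soundʳ a {b} Bb = proj₂ (proj₂ (selector a b) (b , inj₂ refl , Bb))

  -- A member a of B makes (ab)c, hence a(bc), nonempty.
  definedOutside : ∀ {n a b c} → length a ≡ n → length b ≡ n → length c ≡ n → B a → Satisfiable (f b c)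
  definedOutside {n} {a} {b} {c} a≡n b≡n c≡n Ba =
    let t , t∈ab = definedˡ b Ba
        z , z∈tc = definedˡ c (soundˡ b Ba t∈ab)
        y , y∈bc , _ = proj₂ (associative n a b c a≡n b≡n c≡n) (t , t∈ab , z∈tc)
    in y , y∈bc

  -- The two strings to be avoided coincide at length 0, but there the only string cannot be both
  -- inside and outside `B`.
  mixed≢0 : ∀ {n x y} → length x ≡ n → length y ≡ n → B x → ¬ B y → n ≢ 0
  mixed≢0 {x = []} {[]} x≡ y≡ Bx ¬By _ = ¬By Bx
  mixed≢0 {x = _ ∷ _} {_} refl y≡ _ _ ()
  mixed≢0 {x = []} {_ ∷ _} refl () _ _

  outputs : ∀ c {x w o} → o ∈ ordered f c x w ⇔ Computation.Outputs M (query c x w) o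
  outputs false = computes _ _ _
  outputs true  = computes _ _ _

  ordered-soundˡ : ∀ c {x w} → B x → ordered f c x w ⊆ B
  ordered-soundˡ false Bx = soundˡ _ Bx
  ordered-soundˡ true  Bx = soundʳ _ Bx

  ordered-soundʳ : ∀ c {x w} → B w → ordered f c x w ⊆ B
  ordered-soundʳ false Bw = soundʳ _ Bw
  ordered-soundʳ true  Bw = soundˡ _ Bw

  member-advice : ∀ n → ∃ (AdviceAt em M false B n)
  member-advice n = adviceAt em M false B n λ {x₀} {y₀} x₀≡n y₀≡n Bx₀ ¬By₀ →
    let c , w , (w≡n , Bw) , w≢ , x∈ =
          weakest proj₁ (x₀ , x₀≡n , Bx₀) (replicate n) (replicate-injective (mixed≢0 x₀≡n y₀≡n Bx₀ ¬By₀))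
    in c , w , w≡n , w≢ , λ x x≡n → mk⇔
         (λ Bx → x , to (outputs c) (x∈ x (x≡n , Bx)) , dec-true (x ≟ˢ x) refl)
         -- As `w` is in `B`, all values on this pair are in `B`, so an output equal to `x`
         -- certifies `x`.
         (λ (o , out , eq) → subst B (does-true eq) (ordered-soundʳ c Bw (from (outputs c) out)))
    where
    open Selection em f (λ x → length x ≡ n × B x) selective (λ (_ , Ba) _ → definedˡ _ Ba)
      (λ (a≡ , _) (b≡ , _) (c≡ , _) → associative n _ _ _ a≡ b≡ c≡)

  nonmember-advice : ∀ n → ∃ (AdviceAt em M true (∁ B) n)
  nonmember-advice n = adviceAt em M true (∁ B) n λ {y₀} {x₀} y₀≡n x₀≡n ¬By₀ ¬¬Bx₀ →
    let Bx₀ = decidable-stable em ¬¬Bx₀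
        c , v , (v≡n , ¬Bv) , v≢ , v∈ =
          Selection.strongest em f (λ x → length x ≡ n × ¬ B x) selective
            (λ (a≡ , _) (b≡ , _) → definedOutside x₀≡n a≡ b≡ Bx₀)
            (λ (a≡ , _) (b≡ , _) (c≡ , _) → associative n _ _ _ a≡ b≡ c≡)
            proj₁ (y₀ , y₀≡n , ¬By₀) (replicate n) (replicate-injective (mixed≢0 x₀≡n y₀≡n Bx₀ ¬By₀))
    in c , v , v≡n , v≢ , λ x x≡n → mk⇔
         (λ ¬Bx → v , to (outputs c) (v∈ x (x≡n , ¬Bx)) , dec-true (v ≟ˢ v) refl)
         -- If `x` were in `B`, no value on this pair could be `v`.
         (λ (o , out , eq) Bx → ¬Bv (subst B (does-true eq) (ordered-soundˡ c Bx (from (outputs c) out))))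

  advise : ∀ {M : NTM} {β Z} → (∀ n → ∃ (AdviceAt em M β Z n)) →
    ∃[ h ] ∀ x → length (h (length x)) ≡ length x + 1 ×
                 (x ∈ Z ⇔ Verdict.Verdict M β ⟨ x , h (length x) ⟩ true)
  advise h = proj₁ ∘ h , λ x →
    let h-length , Z⇔ = proj₂ (h (length x)) in h-length , Z⇔ x refl

  NP/n+1-member : Computation.PolynomialTime M → (NP /n+1) B
  NP/n+1-member poly =
    let h , h-correct = advise member-advice
    in _ , h , verdict-NP M false true poly , h-correct

  coNP/n+1-member : Computation.PolynomialTime M → (coNP /n+1) B
  coNP/n+1-member poly =
    let h , h-correct = advise nonmember-advice
    in (λ s → ¬ Verdict.Verdict M true s true) , h ,
       -- The complement of the chosen language is a doubly negated verdict.
       NP-resp-⇔ (λ s → mk⇔ (λ V ¬V → ¬V V) (decidable-stable em)) (verdict-NP M true true poly) ,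
       λ x → proj₁ (h-correct x) , mk⇔
         (λ Bx V → from (proj₂ (h-correct x)) V Bx)
         (λ ¬V → decidable-stable em (λ ¬Bx → ¬V (to (proj₂ (h-correct x)) ¬Bx)))

  NP∩coNP/n+1-member : Computation.PolynomialTime M → Total f → SingleValued f → ((NP ∩ coNP) /n+1) B
  NP∩coNP/n+1-member poly f-total f-single =
    let h , h-correct = advise member-advice
    in _ , h , verdict-NP∩coNP
         (λ x y → let z , z∈ = f-total x y in z , to (computes x y z) z∈)
         (λ x y out out′ → f-single x y (from (computes x y _) out) (from (computes x y _) out′)) poly , h-correct

-- Diagonalisation against coded machines

-- This is 2^a (2b + 1): the power of two and the odd part of a positive number are unique.
pair : ℕ → ℕ → ℕ
pair zero    b = suc (2 * b)
pair (suc a) b = 2 * pair a b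

pair-injective : ∀ a a′ {b b′} → pair a b ≡ pair a′ b′ → a ≡ a′ × b ≡ b′
pair-injective zero    zero     {b} {b′} eq = refl , *-cancelˡ-≡ b b′ 2 (suc-injective eq)
pair-injective zero    (suc a′) {b} {b′} eq = contradiction (sym eq) (even≢odd (pair a′ b′) b)
pair-injective (suc a) zero     {b} {b′} eq = contradiction eq (even≢odd (pair a b) b′)
pair-injective (suc a) (suc a′) eq with pair-injective a a′ (*-cancelˡ-≡ (pair a _) (pair a′ _) 2 eq)
... | refl , b≡b′ = refl , b≡b′

list↣ℕ : ∀ {A : Set} → A ↣ ℕ → List A ↣ ℕ
list↣ℕ {A} A↣ℕ = mk↣ {to = encodeList} (encodeList-injective _ _)
  where
  encodeList : List A → ℕ
  encodeList []       = 0
  encodeList (x ∷ xs) = suc (pair (Injection.to A↣ℕ x) (encodeList xs))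
  encodeList-injective : ∀ xs ys → encodeList xs ≡ encodeList ys → xs ≡ ys
  encodeList-injective []       []       eq = refl
  encodeList-injective (x ∷ xs) (y ∷ ys) eq =
    let x≡y , xs≡ys = pair-injective (Injection.to A↣ℕ x) (Injection.to A↣ℕ y) (suc-injective eq)
    in cong₂ _∷_ (Injection.injective A↣ℕ x≡y) (encodeList-injective xs ys xs≡ys)

vec↣ℕ : ∀ {A : Set} {n} → A ↣ ℕ → Vec A n ↣ ℕ
vec↣ℕ {A} A↣ℕ = mk↣ {to = encodeVec} (encodeVec-injective _ _)
  where
  encodeVec : ∀ {n} → Vec A n → ℕ
  encodeVec []       = 0
  encodeVec (x ∷ xs) = pair (Injection.to A↣ℕ x) (encodeVec xs)
  encodeVec-injective : ∀ {n} (xs ys : Vec A n) → encodeVec xs ≡ encodeVec ys → xs ≡ ys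
  encodeVec-injective []       []       eq = refl
  encodeVec-injective (x ∷ xs) (y ∷ ys) eq =
    let x≡y , xs≡ys = pair-injective (Injection.to A↣ℕ x) (Injection.to A↣ℕ y) eq
    in cong₂ _∷_ (Injection.injective A↣ℕ x≡y) (encodeVec-injective xs ys xs≡ys)

fin↣ℕ : ∀ {n} → Fin n ↣ ℕ
fin↣ℕ = mk↣ toℕ-injective

move↣ℕ : Move ↣ ℕ
move↣ℕ = mk↣ {to = λ { ◂ → 0 ; stay → 1 ; ▸ → 2 }} λ
  { {◂} {◂} _ → refl ; {stay} {stay} _ → refl ; {▸} {▸} _ → refl }

maybeBool↣ℕ : Maybe Bool ↣ ℕ
maybeBool↣ℕ = mk↣ {to = encodeMaybe} (encodeMaybe-injective _ _)
  where
  encodeMaybe : Maybe Bool → ℕ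
  encodeMaybe nothing      = 0
  encodeMaybe (just false) = 1
  encodeMaybe (just true)  = 2
  encodeMaybe-injective : ∀ x y → encodeMaybe x ≡ encodeMaybe y → x ≡ y
  encodeMaybe-injective nothing      nothing      _ = refl
  encodeMaybe-injective (just false) (just false) _ = refl
  encodeMaybe-injective (just true)  (just true)  _ = refl
  encodeMaybe-injective nothing      (just false) ()
  encodeMaybe-injective nothing      (just true)  ()
  encodeMaybe-injective (just false) nothing      ()
  encodeMaybe-injective (just false) (just true)  ()
  encodeMaybe-injective (just true)  nothing      ()
  encodeMaybe-injective (just true)  (just false) ()

action↣ℕ : ∀ {q s k} → Action (Fin q) (Fin s) k ↣ ℕ
action↣ℕ = mk↣ {to = λ (action q ss ms e) →
    pair (toℕ q) (pair (Injection.to (vec↣ℕ fin↣ℕ) ss)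
      (pair (Injection.to (vec↣ℕ move↣ℕ) ms) (Injection.to maybeBool↣ℕ e)))}
  λ {(action q ss ms e)} {(action q′ ss′ ms′ e′)} eq →
    let q≡  , eq₁ = pair-injective (toℕ q) (toℕ q′) eq
        ss≡ , eq₂ = pair-injective (Injection.to (vec↣ℕ fin↣ℕ) ss) (Injection.to (vec↣ℕ fin↣ℕ) ss′) eq₁
        ms≡ , e≡  = pair-injective (Injection.to (vec↣ℕ move↣ℕ) ms) (Injection.to (vec↣ℕ move↣ℕ) ms′) eq₂
    in cong-action (toℕ-injective q≡) (Injection.injective (vec↣ℕ fin↣ℕ) ss≡)
                   (Injection.injective (vec↣ℕ move↣ℕ) ms≡) (Injection.injective maybeBool↣ℕ e≡)
  where
  cong-action : ∀ {Q Γ : Set} {k} {q q′ : Q} {ss ss′ : Vec Γ k} {ms ms′ e e′} →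
    q ≡ q′ → ss ≡ ss′ → ms ≡ ms′ → e ≡ e′ → action q ss ms e ≡ action q′ ss′ ms′ e′
  cong-action refl refl refl refl = refl

codeFun : ∀ {n} → (Fin n → ℕ) → ℕ
codeFun g = Injection.to (vec↣ℕ (mk↣ id)) (tabulate g)

codeFun-injective : ∀ {n} (g g′ : Fin n → ℕ) → codeFun g ≡ codeFun g′ → ∀ i → g i ≡ g′ i
codeFun-injective g g′ eq i =
  trans (sym (lookup∘tabulate g i))
    (trans (cong (λ v → Vec.lookup v i) (Injection.injective (vec↣ℕ (mk↣ id)) {tabulate g} {tabulate g′} eq))
      (lookup∘tabulate g′ i))

codeTable : ∀ {s} t → (Vec (Fin s) t → ℕ) → ℕ
codeTable zero    g = g []
codeTable (suc t) g = codeFun λ i → codeTable t λ v → g (i ∷ v)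

codeTable-injective : ∀ {s} t (g g′ : Vec (Fin s) t → ℕ) → codeTable t g ≡ codeTable t g′ → ∀ v → g v ≡ g′ v
codeTable-injective zero    g g′ eq []      = eq
codeTable-injective (suc t) g g′ eq (i ∷ v) =
  codeTable-injective t (λ v → g (i ∷ v)) (λ v → g′ (i ∷ v)) (codeFun-injective _ _ eq i) v

code : NTM → ℕ
code M = pair #states (pair #extraTapes (pair #extraSymbols (pair (toℕ start) (pair (toℕ accept)
  (codeFun λ q → codeTable #tapes λ ss → Injection.to (list↣ℕ action↣ℕ) (δ q ss))))))
  where open NTM M

module _ {s k e : ℕ} {start accept : Fin s}
  {δ₁ δ₂ : Fin s → Vec (Fin (3 + e)) (suc k) → List (Action (Fin s) (Fin (3 + e)) (suc k))}
  (δ₁≡δ₂ : ∀ q ss → δ₁ q ss ≡ δ₂ q ss) where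

  private
    machine : (Fin s → Vec (Fin (3 + e)) (suc k) → List (Action (Fin s) (Fin (3 + e)) (suc k))) → NTM
    machine δ = record
      { #states = s ; #extraTapes = k ; #extraSymbols = e ; start = start ; accept = accept ; δ = δ }
    module C₁ = Computation (machine δ₁)
    module C₂ = Computation (machine δ₂)

    convert : C₁.Config → C₂.Config
    convert (C₁.config q ts o) = C₂.config q ts o

    path : ∀ {c t d} → C₁.Path c t d → C₂.Path (convert c) t (convert d)
    path C₁.done                  = C₂.done
    path (C₁.step {c} a ≢acc a∈ π) = C₂.step a ≢acc (subst (a ∈ˡ_) (δ₁≡δ₂ _ _) a∈) (path π)

    bit-cong : ∀ b → C₁.bit b ≡ C₂.bit b
    bit-cong false = refl
    bit-cong true  = refl

    initial-cong : ∀ w → convert (C₁.initial w) ≡ C₂.initial w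
    initial-cong []      = refl
    initial-cong (b ∷ w) = cong (λ t → C₂.config start (t ∷ Vec.replicate k (tape [] zero [])) [])
      (cong₂ (tape []) (bit-cong b) (map-cong bit-cong w))

  -- Equal codes give transition functions that agree pointwise, so paths are translated instead of
  -- machines being identified.
  outputs-cong : ∀ {w z} → C₁.Outputs w z → C₂.Outputs w z
  outputs-cong {w} (t , d , π , acc , out) =
    t , convert d , subst (λ c → C₂.Path c t (convert d)) (initial-cong w) (path π) , acc , out

-- States and tables have types depending on the sizes. Comparing them as numbers makes the
-- equations well typed before the sizes are identified.
code-outputs : ∀ M M′ → code M ≡ code M′ →
               ∀ {w z} → Computation.Outputs M w z → Computation.Outputs M′ w z
code-outputs M M′ eq
  with s≡ , eq₁ ← pair-injective (NTM.#states M) (NTM.#states M′) eq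
  with k≡ , eq₂ ← pair-injective (NTM.#extraTapes M) (NTM.#extraTapes M′) eq₁
  with e≡ , eq₃ ← pair-injective (NTM.#extraSymbols M) (NTM.#extraSymbols M′) eq₂
  with start≡ , eq₄ ← pair-injective (toℕ (NTM.start M)) (toℕ (NTM.start M′)) eq₃
  with accept≡ , δ≡ ← pair-injective (toℕ (NTM.accept M)) (toℕ (NTM.accept M′)) eq₄ =
  same M M′ s≡ k≡ e≡ start≡ accept≡ δ≡
  where
  table : (M : NTM) → ℕ
  table M = codeFun λ q → codeTable #tapes λ ss → Injection.to (list↣ℕ action↣ℕ) (δ q ss)
    where open NTM M
  same : ∀ M M′ → NTM.#states M ≡ NTM.#states M′ → NTM.#extraTapes M ≡ NTM.#extraTapes M′ →
    NTM.#extraSymbols M ≡ NTM.#extraSymbols M′ →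
    toℕ (NTM.start M) ≡ toℕ (NTM.start M′) → toℕ (NTM.accept M) ≡ toℕ (NTM.accept M′) →
    table M ≡ table M′ →
    ∀ {w z} → Computation.Outputs M w z → Computation.Outputs M′ w z
  same record { #states = s ; #extraTapes = k ; #extraSymbols = e ; start = start ; accept = accept ; δ = δ }
       record { start = start′ ; accept = accept′ ; δ = δ′ } refl refl refl start≡ accept≡ δ≡
    with toℕ-injective {i = start} {start′} start≡ | toℕ-injective {i = accept} {accept′} accept≡
  ... | refl | refl = outputs-cong λ q ss → Injection.injective (list↣ℕ action↣ℕ)
    (codeTable-injective (suc k)
      (λ ss → Injection.to (list↣ℕ action↣ℕ) (δ q ss)) (λ ss → Injection.to (list↣ℕ action↣ℕ) (δ′ q ss))
      (codeFun-injective _ _ δ≡ q) ss)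

-- A total single-valued machine whose verdict language lies in NP ∩ coNP; the diagonal language
-- consults it through reserved advice only.
silent : NTM
silent = record
  { #states = 1 ; #extraTapes = 0 ; #extraSymbols = 0 ; start = zero ; accept = zero ; δ = λ _ _ → [] }

silent-polynomialTime : Computation.PolynomialTime silent
silent-polynomialTime = [] , λ
  { w Computation.done → z≤n
  ; w (Computation.step _ ≢accept _ _) → contradiction refl ≢accept
  }

silent-outputs : ∀ w → Computation.Outputs silent w []
silent-outputs w = 0 , _ , Computation.done , refl , refl

silent-functional : ∀ w {o o′} → Computation.Outputs silent w o → Computation.Outputs silent w o′ → o ≡ o′
silent-functional w out out′ = trans (empty out) (sym (empty out′))
  where
  empty : ∀ {o} → Computation.Outputs silent w o → o ≡ []
  empty (_ , _ , Computation.done , _ , refl) = refl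
  empty (_ , _ , Computation.step _ ≢accept _ _ , _) = contradiction refl ≢accept

zeros : ℕ → Str
zeros n = replicate n false

-- The diagonal language

module Diagonal (em : ExcludedMiddle 0ℓ) where

  even odd : NTM → Str
  even M = zeros (2 * code M)
  odd M  = zeros (suc (2 * code M))

  SelectsEven : NTM → Set
  SelectsEven M = Computation.Outputs M ⟨ even M , odd M ⟩ (even M)

  -- Exactly one of the two strings of a machine belongs to the diagonal language, and it is the
  -- one that the machine does not select.
  Length : ℕ → Set
  Length n = ∃[ M ] ((n ≡ 2 * code M × ¬ SelectsEven M) ⊎ (n ≡ suc (2 * code M) × SelectsEven M))

  Diagonal : Language
  Diagonal x = Length (length x)

  -- `Length` ranges over all machines with a given code, so they must agree on the selection for
  -- the two cases to exclude each other.
  selectsEven-code : ∀ M M′ → code M ≡ code M′ → SelectsEven M → SelectsEven M′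
  selectsEven-code M M′ eq sel =
    subst (λ n → Computation.Outputs M′ ⟨ zeros (2 * n) , zeros (suc (2 * n)) ⟩ (zeros (2 * n))) eq
      (code-outputs M M′ eq sel)

  even∈ : ∀ M → Diagonal (even M) ⇔ (¬ SelectsEven M)
  even∈ M = mk⇔
    (λ { (M′ , inj₁ (eq , ¬sel)) sel → ¬sel (selectsEven-code M M′ (double-injective M′ eq) sel)
       ; (M′ , inj₂ (eq , _)) _ → even≢odd (code M) (code M′) (trans (sym (length-replicate (2 * code M))) eq) })
    (λ ¬sel → M , inj₁ (length-replicate (2 * code M) , ¬sel))
    where
    double-injective : ∀ M′ → length (even M) ≡ 2 * code M′ → code M ≡ code M′
    double-injective M′ eq = *-cancelˡ-≡ (code M) (code M′) 2 (trans (sym (length-replicate (2 * code M))) eq)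

  odd∈ : ∀ M → Diagonal (odd M) ⇔ SelectsEven M
  odd∈ M = mk⇔
    (λ { (M′ , inj₂ (eq , sel)) → selectsEven-code M′ M (double-injective M′ (suc-injective eq)) sel
       ; (M′ , inj₁ (eq , _)) → contradiction (trans (sym eq) (cong suc (length-replicate (2 * code M))))
                                  (even≢odd (code M′) (code M)) })
    (λ sel → M , inj₂ (cong suc (length-replicate (2 * code M)) , sel))
    where
    double-injective : ∀ M′ → length (even M) ≡ 2 * code M′ → code M′ ≡ code M
    double-injective M′ eq = sym (*-cancelˡ-≡ (code M) (code M′) 2 (trans (sym (length-replicate (2 * code M))) eq))

  -- Membership depends on the length alone, so the advice is always "accept all" or "reject all".
  diagonal-NP∩coNP/n+1 : ((NP ∩ coNP) /n+1) Diagonal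
  diagonal-NP∩coNP/n+1 =
    _ , (λ n → does (em {Length n}) ∷ replicate n (does (em {Length n}))) ,
    verdict-NP∩coNP {silent} {false} (λ x y → [] , silent-outputs ⟨ x , y ⟩) (λ x y → silent-functional ⟨ x , y ⟩)
      silent-polynomialTime ,
    λ x → trans (cong suc (length-replicate (length x))) (+-comm 1 (length x)) ,
          subst (Diagonal x ⇔_)
            (sym (constant-verdict {silent} {false} x (does (em {Diagonal x})) (length x) true)) (decided em)
    where
    decided : ∀ {P : Set} (P? : Dec P) → P ⇔ does P? ≡ true
    decided (yes p) = mk⇔ (λ _ → refl) (λ _ → p)
    decided (no ¬p) = mk⇔ (λ p → contradiction p ¬p) (λ ())

  -- If `M` can output `even M`, then only `odd M` is in the language and that output is illegal. If
  -- not, `even M` is in it, yet the required value can only be `odd M`, which is outside.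
  diagonal-¬selective : ¬ Aℓ-NPMV-sel Diagonal
  diagonal-¬selective (f , (M , _ , computes) , selector , _) = case em
    where
    open Equivalence renaming (to to ⇒; from to ⇐)
    case : Dec (SelectsEven M) → _
    case (yes sel) = ⇒ (even∈ M)
      (proj₂ (proj₂ (selector (even M) (odd M)) (odd M , inj₂ refl , ⇐ (odd∈ M) sel)) (⇐ (computes _ _ _) sel)) sel
    case (no ¬sel) with proj₂ (selector (even M) (odd M)) (even M , inj₁ refl , ⇐ (even∈ M) ¬sel)
    ... | (z , z∈) , f⊆ with proj₁ (selector (even M) (odd M)) z∈
    ...   | inj₁ refl = ¬sel (⇒ (computes _ _ _) z∈)
    ...   | inj₂ refl = ¬sel (⇒ (odd∈ M) (f⊆ z∈))

theorem5p9 : ExcludedMiddle 0ℓ →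
    (Aℓ-NP-sel ⊂ (NP ∩ coNP) /n+1) ×
    (Aℓ-NPMV-sel ⊂ NP /n+1 ∩ coNP /n+1)
theorem5p9 em =
  ( (λ { (f , ((M , poly , computes) , total , single) , selector , associative) →
         Inclusion.NP∩coNP/n+1-member em computes selector associative poly total single })
  -- An `NPSVₜ` selector is in particular an `NPMV` selector, so one diagonal language separates
  -- both pairs of classes.
  , λ ⊇ → let f , (f∈NPMV , _) , selector , associative = ⊇ diagonal-NP∩coNP/n+1
          in diagonal-¬selective (f , f∈NPMV , selector , associative) ) ,
  ( (λ { (f , (M , poly , computes) , selector , associative) →
         Inclusion.NP/n+1-member em computes selector associative poly ,
         Inclusion.coNP/n+1-member em computes selector associative poly })
  , λ ⊇ → let C , h , (C∈NP , C∈coNP) , correct = diagonal-NP∩coNP/n+1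
          in diagonal-¬selective (⊇ ((C , h , C∈NP , correct) , (C , h , C∈coNP , correct))) )
  where open Diagonal em
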